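{- Let $\mathcal{G}_{g_2}(n)$ be the set of all unicyclic graphs on $n$ vertices with even girth, and let $S_4'=G_4(0,0;0,0;0,0;0,n-4)$ (a 4-cycle with $n-4$ pendent edges attached at one vertex). Then $\varphi_i(G)\ge\varphi_i(S_4')$ for every $G\in\mathcal{G}_{g_2}(n)$ and every $i=0,1,\dots,n$.
   Context: A unicyclic graph is a simple connected graph containing exactly one cycle; its girth is the length of that cycle. For a graph $G$ on $n$ vertices let $Q(G)=D(G)+A(G)$ be its signless Laplacian matrix ($D(G)$ degree diagonal matrix, $A(G)$ adjacency matrix), and write $\det(xI-Q(G))=\sum_{i=0}^{n}(-1)^i\varphi_i(G)x^{n-i}$. For $g\ge 3$ and nonnegative integers $s_j,t_j$, $G_g(s_1,t_1;\dots;s_g,t_g)$ denotes the connected unicyclic graph obtained from a cycle $u_1u_2\cdots u_gu_1$ by attaching, at each vertex $u_j$, $s_j$ pendent paths of length $2$ and $t_j$ pendent edges. -}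

module Defs where

open import Data.Nat as ℕ using (ℕ; zero; suc; _<ᵇ_; _≡ᵇ_)
open import Data.Integer as ℤ using (ℤ; +_; -_)
open import Data.Fin using (Fin; zero; suc; toℕ; fromℕ; inject₁; punchIn)
open import Data.List using (List; []; _∷_; map)
open import Data.Bool using (Bool; true; false; if_then_else_; _∧_; _∨_)
open import Data.Product using (Σ; ∃; _×_; _,_)
open import Data.Sum using (_⊎_)
open import Relation.Binary.PropositionalEquality using (_≡_)
open import Function.Definitions using (Injective)
open import Function.Bundles using (_⇔_)

Graph : ℕ → Set
Graph n = Fin n → Fin n → Bool

Simple : ∀ {n} → Graph n → Set
Simple {n} G = (∀ i j → G i j ≡ G j i) × (∀ i → G i i ≡ false)

Connected : ∀ {n} → Graph n → Set
Connected {n} G = ∀ (u v : Fin n) → ∃ λ (k : ℕ) → Σ (Fin (suc k) → Fin n) λ p →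
  (p zero ≡ u) × (p (fromℕ k) ≡ v) × (∀ (i : Fin k) → G (p (inject₁ i)) (p (suc i)) ≡ true)

CSucc : (k : ℕ) → Fin k → Fin k → Set
CSucc k i j = (suc (toℕ i) ≡ toℕ j) ⊎ ((suc (toℕ i) ≡ k) × (toℕ j ≡ 0))

IsCycle : ∀ {n} → Graph n → (k : ℕ) → (Fin k → Fin n) → Set
IsCycle G k c = (3 ℕ.≤ k) × Injective _≡_ _≡_ c × (∀ i j → CSucc k i j → G (c i) (c j) ≡ true)

CycleEdge : ∀ {n k} → (Fin k → Fin n) → Fin n → Fin n → Set
CycleEdge {n} {k} c u w = ∃ λ i → ∃ λ j → CSucc k i j × (((c i ≡ u) × (c j ≡ w)) ⊎ ((c i ≡ w) × (c j ≡ u)))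

-- unicyclic: simple, connected, has a cycle, and all cycles have the same edge set
-- (i.e. they are the same cycle as a subgraph)
Unicyclic : ∀ {n} → Graph n → Set
Unicyclic {n} G = Simple G × Connected G
  × (∃ λ k → Σ (Fin k → Fin n) λ c → IsCycle G k c)
  × (∀ k (c : Fin k → Fin n) k' (c' : Fin k' → Fin n) → IsCycle G k c → IsCycle G k' c' →
       ∀ u w → CycleEdge c u w ⇔ CycleEdge c' u w)

-- the girth (length of the unique cycle) is even
EvenGirth : ∀ {n} → Graph n → Set
EvenGirth {n} G = ∃ λ k → Σ (Fin k → Fin n) λ c → IsCycle G k c × (∃ λ m → k ≡ 2 ℕ.* m)

-- Integer polynomials as coefficient lists (lowest degree first)

Poly : Set
Poly = List ℤ

addP : Poly → Poly → Poly
addP [] q = q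
addP p [] = p
addP (a ∷ p) (b ∷ q) = (a ℤ.+ b) ∷ addP p q

scaleP : ℤ → Poly → Poly
scaleP c p = map (c ℤ.*_) p

mulP : Poly → Poly → Poly
mulP [] q = []
mulP (a ∷ p) q = addP (scaleP a q) (+ 0 ∷ mulP p q)

coeff : Poly → ℕ → ℤ
coeff [] k = + 0
coeff (a ∷ p) zero = a
coeff (a ∷ p) (suc k) = coeff p k

sgn : ℕ → ℤ
sgn zero = + 1
sgn (suc k) = - sgn k

sumP : ∀ {n} → (Fin n → Poly) → Poly
sumP {zero} f = []
sumP {suc n} f = addP (f zero) (sumP (λ i → f (suc i)))

det : ∀ n → (Fin n → Fin n → Poly) → Poly
det zero M = + 1 ∷ []
det (suc n) M = sumP (λ j → scaleP (sgn (toℕ j))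
                   (mulP (M zero j) (det n (λ r s → M (suc r) (punchIn j s)))))

-- signless Laplacian Q(G) = D(G) + A(G), and its characteristic polynomial

b2ℤ : Bool → ℤ
b2ℤ true = + 1
b2ℤ false = + 0

sumℕ : ∀ {n} → (Fin n → ℕ) → ℕ
sumℕ {zero} f = 0
sumℕ {suc n} f = f zero ℕ.+ sumℕ (λ i → f (suc i))

degree : ∀ {n} → Graph n → Fin n → ℕ
degree G v = sumℕ (λ w → if G v w then 1 else 0)

-- entries of x I - Q(G) as polynomials in x
charMat : ∀ {n} → Graph n → Fin n → Fin n → Poly
charMat G i j with toℕ i ≡ᵇ toℕ j
... | true  = - (+ degree G i) ∷ + 1 ∷ []
... | false = - b2ℤ (G i j) ∷ []

charPoly : ∀ {n} → Graph n → Poly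
charPoly {n} G = det n (charMat G)

-- det(xI - Q(G)) = Σ_i (-1)^i φ_i(G) x^(n-i)
φ : ∀ {n} → Graph n → ℕ → ℤ
φ {n} G i = sgn i ℤ.* coeff (charPoly G) (n ℕ.∸ i)

-- S₄' = G₄(0,0;0,0;0,0;0,n-4) on n = m + 4 vertices:
-- cycle 0-1-2-3-0, and vertices 4..n-1 pendent at vertex 3 (= u₄)

s4edge : ℕ → ℕ → Bool
s4edge a b = ((a ≡ᵇ 0) ∧ (b ≡ᵇ 1)) ∨ ((a ≡ᵇ 1) ∧ (b ≡ᵇ 2)) ∨ ((a ≡ᵇ 2) ∧ (b ≡ᵇ 3))
           ∨ ((a ≡ᵇ 3) ∧ (b ≡ᵇ 0)) ∨ ((a ≡ᵇ 3) ∧ (3 <ᵇ b))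

S4' : (m : ℕ) → Graph (m ℕ.+ 4)
S4' m i j = s4edge (toℕ i) (toℕ j) ∨ s4edge (toℕ j) (toℕ i)

{-# OPTIONS --safe #-}
module Submission where

-- Weight each vertex v of G by w(v) and let D(G, w) = det (diag w + Q(G)); up to sign φᵢ(G) is a
-- coefficient of D(G, x), and Q(G) may be expanded row by row into the vectors δᵢ + δₖ, one for each
-- arc i → k.  Column operations show that every determinant arising in this way has nonnegative
-- coefficients, so D is monotone in the edges, and G may be replaced by its even cycle together
-- with pendent edges attached one at a time.
--
-- Attaching a pendent vertex v at u gives D = w(v) D(G, w) + D(G, w + w(v) δᵤ): delete or contract
-- the edge.  For weights x (1 + aᵥ) this yields by induction a lower bound L_h(∑ a), affine in ∑ a,
-- with L_{h+1}(a) = x L_h(a) + L_h(a + 1), and equality when all edges are attached at the vertex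
-- carrying a.  Deleting or contracting an edge of a cycle reduces longer cycles to the 4-cycle and
-- to paths, where the bound is a polynomial inequality with nonnegative difference.

-- Weights make the induction close. Contracting an edge adds the weights of its ends, so the bound
-- has to hold for all weights x (1 + aᵥ) at once; in these coordinates each contraction raises ∑ a
-- by exactly one. A bound in ∑ a alone is possible because, on the 4-cycle, what the determinant
-- has beyond it consists of products of different aᵥ with nonnegative coefficients, which vanish
-- when a sits at one vertex.
--
-- Evenness enters through a sign. Contracting the closing edge of a cycle changes the sign of the
-- edge that takes its place, from signless to ordinary Laplacian or back. A cycle of length 4 + h
-- is therefore closed by an edge of sign (-1)ʰ, so that the descent ends at the true 4-cycle; for
-- even h this is the cycle of the graph itself.
--
-- The argument runs over any commutative ring with a cone closed under sums and products. In the
-- end the ring is ℤ[X], x is -X, and the cone consists of the polynomials with alternating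
-- coefficients; this absorbs both the sign (-1)ⁿ between det (xI - Q) and det (-xI + Q) and the
-- sign (-1)ⁱ of φᵢ.

open import Algebra.Bundles using (CommutativeRing)
open import Algebra.Solver.Ring.AlmostCommutativeRing using (_-Raw-AlmostCommutative⟶_; fromCommutativeRing)
open import Data.Bool using (Bool; true; false; T; _∨_; if_then_else_)
open import Data.Bool.Properties using (∨-identityʳ; ∨-comm)
open import Data.Empty using (⊥-elim)
open import Data.Fin using (Fin; zero; suc; toℕ; fromℕ; inject₁; punchIn; punchOut; _≟_)
open import Data.Fin.Patterns using (0F; 1F; 2F; 3F; 4F; 5F)
open import Data.Fin.Properties using (any?; ¬∀⟶∃¬; injective⇒≤; punchIn-punchOut; punchOut-injective; punchIn-injective; punchInᵢ≢i; suc-injective; 0≢1+n; toℕ-fromℕ; toℕ-injective)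
open import Data.Integer as ℤ using (ℤ; +_; -[1+_]; +0; +[1+_])
open import Data.Integer.Properties as ℤₚ using ()
open import Data.Integer.Solver using (module +-*-Solver)
open import Data.List using (List; []; _∷_; map)
open import Data.Maybe as Maybe using (Maybe)
open import Data.Nat as ℕ using (ℕ; zero; suc; _≡ᵇ_)
open import Data.Nat.Properties as ℕₚ using ()
open import Data.Product using (Σ; ∃; _×_; _,_; proj₁; proj₂)
open import Data.Sum using (_⊎_; inj₁; inj₂)
open import Data.Vec using (Vec; []; _∷_; lookup; tabulate)
open import Data.Vec.Properties using (lookup∘tabulate)
open import Defs using (Graph; Simple; Connected; IsCycle; EvenGirth; Poly; addP; scaleP; mulP; coeff; sgn; s4edge; S4')
open import Function.Definitions using (Injective)
open import Level using (0ℓ; _⊔_)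
open import Relation.Binary.PropositionalEquality as ≡ using (_≡_; _≢_)
open import Relation.Nullary using (¬_; yes; no; contradiction)
open import Relation.Nullary.Decidable using (dec⇒maybe)

-- A ring solver with integer coefficients over any commutative ring.

module IntegerSolver {c ℓ} (R : CommutativeRing c ℓ) where
  open CommutativeRing R hiding (zero)
  open import Algebra.Properties.Ring ring
  open import Algebra.Properties.Semiring.Mult.TCOptimised semiring using (×-homo-+; ×1-homo-*; 1+×) renaming (_×_ to _·_)
  open import Relation.Binary.Reasoning.Setoid setoid
  open import Algebra.Properties.CommutativeSemigroup +-commutativeSemigroup using (interchange)

  -- With this multiple, `fromℤ (+ 0)` and `fromℤ (+ 1)` compute to `0#` and `1#`, so the constants
  -- of a solver goal match those of a ring expression by computation.
  fromℤ : ℤ → Carrier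
  fromℤ (+ n)    = n · 1#
  fromℤ -[1+ n ] = - (suc n · 1#)

  fromℤ-⊖ : ∀ m n → fromℤ (m ℤ.⊖ n) ≈ m · 1# - n · 1#
  fromℤ-⊖ m       zero    = sym (trans (+-congˡ -0#≈0#) (+-identityʳ _))
  fromℤ-⊖ zero    (suc n) = sym (+-identityˡ _)
  fromℤ-⊖ (suc m) (suc n) = begin
    fromℤ (suc m ℤ.⊖ suc n)                ≡⟨ ≡.cong fromℤ (ℤₚ.[1+m]⊖[1+n]≡m⊖n m n) ⟩
    fromℤ (m ℤ.⊖ n)                        ≈⟨ fromℤ-⊖ m n ⟩
    m · 1# - n · 1#                        ≈⟨ +-identityˡ _ ⟨
    0# + (m · 1# - n · 1#)                 ≈⟨ +-congʳ (-‿inverseʳ 1#) ⟨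
    (1# - 1#) + (m · 1# - n · 1#)          ≈⟨ interchange 1# (- 1#) (m · 1#) (- (n · 1#)) ⟩
    (1# + m · 1#) + (- 1# + - (n · 1#))    ≈⟨ +-congˡ (-‿+-comm 1# (n · 1#)) ⟩
    (1# + m · 1#) - (1# + n · 1#)          ≈⟨ +-cong (1+× m 1#) (-‿cong (1+× n 1#)) ⟨
    suc m · 1# - suc n · 1#                ∎

  fromℤ-neg : ∀ i → fromℤ (ℤ.- i) ≈ - fromℤ i
  fromℤ-neg +0       = sym -0#≈0#
  fromℤ-neg +[1+ n ] = refl
  fromℤ-neg -[1+ n ] = sym (-‿involutive _)

  fromℤ-+ : ∀ i j → fromℤ (i ℤ.+ j) ≈ fromℤ i + fromℤ j
  fromℤ-+ (+ m)    (+ n)    = ×-homo-+ 1# m n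
  fromℤ-+ (+ m)    -[1+ n ] = fromℤ-⊖ m (suc n)
  fromℤ-+ -[1+ m ] (+ n)    = trans (fromℤ-⊖ n (suc m)) (+-comm _ _)
  fromℤ-+ -[1+ m ] -[1+ n ] = begin
    - (suc (suc (m ℕ.+ n)) · 1#)        ≡⟨ ≡.cong (λ k → - (suc k · 1#)) (ℕₚ.+-suc m n) ⟨
    - ((suc m ℕ.+ suc n) · 1#)          ≈⟨ -‿cong (×-homo-+ 1# (suc m) (suc n)) ⟩
    - (suc m · 1# + suc n · 1#)         ≈⟨ -‿+-comm _ _ ⟨
    - (suc m · 1#) - (suc n · 1#)       ∎

  fromℤ-+* : ∀ m j → fromℤ (+ m ℤ.* j) ≈ m · 1# * fromℤ j
  fromℤ-+* m (+ n)    = trans (reflexive (≡.cong fromℤ (≡.sym (ℤₚ.pos-* m n)))) (×1-homo-* m n)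
  fromℤ-+* m -[1+ n ] = begin
    fromℤ (+ m ℤ.* -[1+ n ])          ≡⟨ ≡.cong fromℤ (ℤₚ.neg-distribʳ-* (+ m) +[1+ n ]) ⟨
    fromℤ (ℤ.- (+ m ℤ.* +[1+ n ]))    ≈⟨ fromℤ-neg (+ m ℤ.* +[1+ n ]) ⟩
    - fromℤ (+ m ℤ.* +[1+ n ])        ≈⟨ -‿cong (fromℤ-+* m +[1+ n ]) ⟩
    - (m · 1# * (suc n · 1#))         ≈⟨ -‿distribʳ-* _ _ ⟩
    m · 1# * - (suc n · 1#)           ∎

  fromℤ-* : ∀ i j → fromℤ (i ℤ.* j) ≈ fromℤ i * fromℤ j
  fromℤ-* (+ m)    j = fromℤ-+* m j
  fromℤ-* -[1+ m ] j = begin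
    fromℤ (-[1+ m ] ℤ.* j)            ≡⟨ ≡.cong fromℤ (ℤₚ.neg-distribˡ-* +[1+ m ] j) ⟨
    fromℤ (ℤ.- (+[1+ m ] ℤ.* j))      ≈⟨ fromℤ-neg (+[1+ m ] ℤ.* j) ⟩
    - fromℤ (+[1+ m ] ℤ.* j)          ≈⟨ -‿cong (fromℤ-+* (suc m) j) ⟩
    - (suc m · 1# * fromℤ j)          ≈⟨ -‿distribˡ-* _ _ ⟩
    - (suc m · 1#) * fromℤ j          ∎

  fromℤ-homomorphism : ℤ.+-*-rawRing -Raw-AlmostCommutative⟶ fromCommutativeRing R
  fromℤ-homomorphism = record
    { ⟦_⟧ = fromℤ ; +-homo = fromℤ-+ ; *-homo = fromℤ-* ; -‿homo = fromℤ-neg ; 0-homo = refl ; 1-homo = refl }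

  fromℤ-≟ : ∀ i j → Maybe (fromℤ i ≈ fromℤ j)
  fromℤ-≟ i j = Maybe.map (λ i≡j → reflexive (≡.cong fromℤ i≡j)) (dec⇒maybe (i ℤ.≟ j))

  open import Algebra.Solver.Ring ℤ.+-*-rawRing (fromCommutativeRing R) fromℤ-homomorphism fromℤ-≟ public
    using (solve; prove; ⟦_⟧; ⟦_⟧↓; con; var; _:+_; _:*_; _:-_; :-_; _:=_; Polynomial)

-- Determinants by expansion along the first row: linearity, transposition, permutations,
-- elimination.

module Determinant {c ℓ} (R : CommutativeRing c ℓ) where
  open CommutativeRing R hiding (zero)
  open import Algebra.Properties.Ring ring
  open import Algebra.Properties.Semiring.Sum semiring
    using (sum; sum-cong-≋; ∑-distrib-+; *-distribˡ-sum; ∑-comm; sum-remove)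
  open import Relation.Binary.Reasoning.Setoid setoid
  open IntegerSolver R

  Mat : ℕ → Set c
  Mat n = Fin n → Fin n → Carrier

  _ᵀ : ∀ {n} → Mat n → Mat n
  (M ᵀ) i j = M j i

  sg : ℕ → Carrier
  sg zero    = 1#
  sg (suc n) = - sg n

  sgF : ∀ {n} → Fin n → Carrier
  sgF i = sg (toℕ i)

  sg-square : ∀ n → sg n * sg n ≈ 1#
  sg-square zero    = *-identityˡ 1#
  sg-square (suc n) = trans (solve 1 (λ a → (:- a) :* (:- a) := a :* a) refl (sg n)) (sg-square n)

  -- Opaque, so that unification can read a summand off a sum and a matrix off a determinant.
  opaque
    ∑ : ∀ {n} → (Fin n → Carrier) → Carrier
    ∑ = sum

    ∑-zero : (f : Fin zero → Carrier) → ∑ f ≈ 0#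
    ∑-zero f = refl

    ∑-suc : ∀ {n} (f : Fin (suc n) → Carrier) → ∑ f ≈ f zero + ∑ (λ j → f (suc j))
    ∑-suc f = refl

    ∑-cong : ∀ {n} {f g : Fin n → Carrier} → (∀ j → f j ≈ g j) → ∑ f ≈ ∑ g
    ∑-cong = sum-cong-≋

    ∑-+ : ∀ {n} (f g : Fin n → Carrier) → ∑ (λ j → f j + g j) ≈ ∑ f + ∑ g
    ∑-+ = ∑-distrib-+

    ∑-* : ∀ {n} a (f : Fin n → Carrier) → a * ∑ f ≈ ∑ (λ j → a * f j)
    ∑-* = *-distribˡ-sum

    ∑-interchange : ∀ {m n} (f : Fin m → Fin n → Carrier) → ∑ (λ i → ∑ (f i)) ≈ ∑ (λ j → ∑ (λ i → f i j))
    ∑-interchange = ∑-comm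

    ∑-remove : ∀ {n} (i : Fin (suc n)) f → ∑ f ≈ f i + ∑ (λ j → f (punchIn i j))
    ∑-remove i f = sum-remove {i = i} f

    det : ∀ n → Mat n → Carrier
    det zero    M = 1#
    det (suc n) M = ∑ (λ j → sgF j * (M zero j * det n (λ r s → M (suc r) (punchIn j s))))

    det-empty : (M : Mat zero) → det zero M ≈ 1#
    det-empty M = refl

    det-expand : ∀ n (M : Mat (suc n)) → det (suc n) M ≈ ∑ (λ j → sgF j * (M zero j * det n (λ r s → M (suc r) (punchIn j s))))
    det-expand n M = refl

  ∑-vanish : ∀ {n} {f : Fin n → Carrier} → (∀ j → f j ≈ 0#) → ∑ f ≈ 0#
  ∑-vanish {zero}  {f} f≈0 = ∑-zero f
  ∑-vanish {suc n} {f} f≈0 = trans (∑-suc f) (trans (+-cong (f≈0 zero) (∑-vanish (λ j → f≈0 (suc j)))) (+-identityˡ 0#))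

  ∑-linear : ∀ {n} a {f g h : Fin n → Carrier} → (∀ j → f j ≈ g j + a * h j) → ∑ f ≈ ∑ g + a * ∑ h
  ∑-linear a {f} {g} {h} eq = begin
    ∑ f                      ≈⟨ ∑-cong eq ⟩
    ∑ (λ j → g j + a * h j)  ≈⟨ ∑-+ g (λ j → a * h j) ⟩
    ∑ g + ∑ (λ j → a * h j)  ≈⟨ +-congˡ (∑-* a h) ⟨
    ∑ g + a * ∑ h            ∎

  det-cong : ∀ n {M N : Mat n} → (∀ i j → M i j ≈ N i j) → det n M ≈ det n N
  det-cong zero    {M} {N} M≈N = trans (det-empty M) (sym (det-empty N))
  det-cong (suc n) {M} {N} M≈N = trans (det-expand n M) (trans
    (∑-cong λ j → *-congˡ {sgF j} (*-cong (M≈N zero j) (det-cong n λ r s → M≈N (suc r) (punchIn j s))))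
    (sym (det-expand n N)))

  -- Recursion on the indices, rather than a decision of equality, lets the entries of rows and
  -- columns reduce after a case split.
  δ : ∀ {n} → Fin n → Fin n → Carrier
  δ zero    zero    = 1#
  δ zero    (suc j) = 0#
  δ (suc i) zero    = 0#
  δ (suc i) (suc j) = δ i j

  δ-sym : ∀ {n} (i j : Fin n) → δ i j ≈ δ j i
  δ-sym zero    zero    = refl
  δ-sym zero    (suc j) = refl
  δ-sym (suc i) zero    = refl
  δ-sym (suc i) (suc j) = δ-sym i j

  δ-diag : ∀ {n} (i : Fin n) → δ i i ≈ 1#
  δ-diag zero    = refl
  δ-diag (suc i) = δ-diag i

  δ-off : ∀ {n} {i j : Fin n} → i ≢ j → δ i j ≈ 0#
  δ-off {i = zero}  {zero}  i≢j = contradiction ≡.refl i≢j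
  δ-off {i = zero}  {suc j} i≢j = refl
  δ-off {i = suc i} {zero}  i≢j = refl
  δ-off {i = suc i} {suc j} i≢j = δ-off (λ i≡j → i≢j (≡.cong suc i≡j))

  δ-punchIn : ∀ {n} (v : Fin (suc n)) i → δ v (punchIn v i) ≈ 0#
  δ-punchIn zero    i       = refl
  δ-punchIn (suc v) zero    = refl
  δ-punchIn (suc v) (suc i) = δ-punchIn v i

  ∑-δ : ∀ {n} (k : Fin n) (f : Fin n → Carrier) → ∑ (λ j → δ k j * f j) ≈ f k
  ∑-δ zero    f = trans (∑-suc _) (trans (+-cong (*-identityˡ _) (∑-vanish (λ j → zeroˡ _))) (+-identityʳ _))
  ∑-δ (suc k) f = trans (∑-suc _) (trans (+-cong (zeroˡ _) (∑-δ k (λ j → f (suc j)))) (+-identityˡ _))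

  ∑-δ-1 : ∀ {n} (k : Fin n) → ∑ (δ k) ≈ 1#
  ∑-δ-1 k = trans (∑-cong (λ i → sym (*-identityʳ _))) (∑-δ k (λ _ → 1#))

  det-linear-expand : ∀ {n a} {A B C : Mat (suc n)} →
    (let t : Mat (suc n) → Fin (suc n) → Carrier
         t = λ M j → sgF j * (M zero j * det n (λ r s → M (suc r) (punchIn j s)))) →
    ∑ (t C) ≈ ∑ (t A) + a * ∑ (t B) → det (suc n) C ≈ det (suc n) A + a * det (suc n) B
  det-linear-expand {n} {a} {A} {B} {C} eq =
    trans (det-expand n C) (trans eq (sym (+-cong (det-expand n A) (*-congˡ (det-expand n B)))))

  -- Row `zero` supplies the coefficients of the expansion; a later row occurs in every minor, where
  -- induction on `v` applies. The other rows are named by `punchIn v`, so no inequality of indices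
  -- has to be carried.
  det-row-linear : ∀ {n} (v : Fin (suc n)) a {A B C : Mat (suc n)} →
    (∀ j → C v j ≈ A v j + a * B v j) →
    (∀ i j → A (punchIn v i) j ≈ C (punchIn v i) j) →
    (∀ i j → B (punchIn v i) j ≈ C (punchIn v i) j) →
    det (suc n) C ≈ det (suc n) A + a * det (suc n) B
  det-row-linear {n} zero a {A} {B} {C} eq A≈C B≈C = det-linear-expand (∑-linear a λ j →
    trans (*-congˡ {sgF j} (*-congʳ (eq j)))
    (trans (solve 5 (λ s x a y d → s :* ((x :+ a :* y) :* d) := s :* (x :* d) :+ a :* (s :* (y :* d))) refl (sgF j) _ a _ _)
    (sym (+-cong (*-congˡ (*-congˡ (det-cong n λ r s → A≈C r (punchIn j s))))
                 (*-congˡ (*-congˡ (*-congˡ (det-cong n λ r s → B≈C r (punchIn j s)))))))))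
  det-row-linear {suc n} (suc v) a {A} {B} {C} eq A≈C B≈C = det-linear-expand (∑-linear a λ j →
    trans (*-congˡ {sgF j} (*-congˡ (det-row-linear v a (λ s → eq (punchIn j s))
                                       (λ i s → A≈C (suc i) (punchIn j s)) (λ i s → B≈C (suc i) (punchIn j s)))))
    (trans (solve 5 (λ s x a d e → s :* (x :* (d :+ a :* e)) := s :* (x :* d) :+ a :* (s :* (x :* e))) refl (sgF j) _ a _ _)
    (sym (+-cong (*-congˡ (*-congʳ (A≈C zero j))) (*-congˡ (*-congˡ (*-congʳ (B≈C zero j))))))))

  -- Expanding along the first row and then along the first column gives a formula symmetric under transposition.
  det-transpose-step : ∀ n → (∀ (M : Mat n) → det n M ≈ det n (M ᵀ)) →
    (∀ (M : Mat (suc n)) → det (suc n) M ≈ det (suc n) (M ᵀ)) →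
    ∀ (M : Mat (suc (suc n))) → det (suc (suc n)) M ≈ det (suc (suc n)) (M ᵀ)
  det-transpose-step n transpose₀ transpose₁ M = begin
    det (suc (suc n)) M                                        ≈⟨ expand M ⟩
    corner M + ∑ (λ j → ∑ (λ i → border M j i))            ≈⟨ +-cong corner-eq (∑-cong λ j → ∑-cong λ i → border-eq j i) ⟩
    corner (M ᵀ) + ∑ (λ j → ∑ (λ i → border (M ᵀ) i j))    ≈⟨ +-congˡ (∑-interchange (λ j i → border (M ᵀ) i j)) ⟩
    corner (M ᵀ) + ∑ (λ i → ∑ (λ j → border (M ᵀ) i j))    ≈⟨ expand (M ᵀ) ⟨
    det (suc (suc n)) (M ᵀ)                                    ∎
    where
    corner : Mat (suc (suc n)) → Carrier
    corner M = 1# * (M zero zero * det (suc n) (λ r s → M (suc r) (suc s)))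
    inner : Mat (suc (suc n)) → Fin (suc n) → Fin (suc n) → Carrier
    inner M j i = det n (λ r s → M (suc (punchIn i r)) (suc (punchIn j s)))
    border : Mat (suc (suc n)) → Fin (suc n) → Fin (suc n) → Carrier
    border M j i = (- sgF j * M zero (suc j)) * (sgF i * (M (suc i) zero * inner M j i))
    column : ∀ M j → det (suc n) (λ r s → M (suc r) (punchIn (suc j) s)) ≈ ∑ (λ i → sgF i * (M (suc i) zero * inner M j i))
    column M j = trans (transpose₁ _) (trans (det-expand n _) (∑-cong λ i → *-congˡ {sgF i} (*-congˡ {M (suc i) zero}
      (transpose₀ (λ s r → M (suc (punchIn i r)) (suc (punchIn j s)))))))
    expand : ∀ M → det (suc (suc n)) M ≈ corner M + ∑ (λ j → ∑ (λ i → border M j i))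
    expand M = trans (det-expand (suc n) M) (trans (∑-suc _) (+-congˡ (∑-cong λ j → trans (sym (*-assoc (- sgF j) _ _))
      (trans (*-congˡ (column M j)) (∑-* (- sgF j * M zero (suc j)) _)))))
    corner-eq : corner M ≈ corner (M ᵀ)
    corner-eq = *-congˡ (*-congˡ (transpose₁ _))
    border-eq : ∀ j i → border M j i ≈ border (M ᵀ) i j
    border-eq j i = trans
      (solve 5 (λ a b x y d → ((:- a) :* x) :* (b :* (y :* d)) := ((:- b) :* y) :* (a :* (x :* d))) refl (sgF j) (sgF i) _ _ _)
      (*-congˡ (*-congˡ (*-congˡ (transpose₀ _))))

  det-transpose : ∀ n (M : Mat n) → det n M ≈ det n (M ᵀ)
  det-transpose zero          M = det-cong zero λ ()
  det-transpose (suc zero)    M = det-cong 1 λ { zero zero → refl }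
  det-transpose (suc (suc n)) M = det-transpose-step n (det-transpose n) (det-transpose (suc n)) M

  -- The first two terms of the expansion have equal minors and opposite signs. Every other minor
  -- still begins with the two equal columns and vanishes by induction.
  det-columns-equal : ∀ n (M : Mat (suc (suc n))) → (∀ i → M i zero ≈ M i (suc zero)) → det (suc (suc n)) M ≈ 0#
  det-columns-equal n M eq = begin
    det (suc (suc n)) M                                    ≈⟨ trans (det-expand (suc n) M) (trans (∑-suc t) (+-congˡ (∑-suc _))) ⟩
    t zero + (t (suc zero) + ∑ (λ j → t (suc (suc j))))  ≈⟨ +-congˡ (+-congˡ (∑-vanish (vanish n M eq))) ⟩
    t zero + (t (suc zero) + 0#)                           ≈⟨ +-congʳ (*-congˡ (*-cong (eq zero) (det-cong (suc n) minor-eq))) ⟩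
    1# * (m * d) + (- 1# * (m * d) + 0#)                   ≈⟨ solve 1 (λ a → con (+ 1) :* a :+ ((:- con (+ 1)) :* a :+ con (+ 0)) := con (+ 0)) refl (m * d) ⟩
    0#                                                     ∎
    where
    t : Fin (suc (suc n)) → Carrier
    t j = sgF j * (M zero j * det (suc n) (λ r s → M (suc r) (punchIn j s)))
    m = M zero (suc zero)
    d = det (suc n) (λ r s → M (suc r) (punchIn (suc zero) s))
    minor-eq : ∀ r s → M (suc r) (suc s) ≈ M (suc r) (punchIn (suc zero) s)
    minor-eq r zero    = sym (eq (suc r))
    minor-eq r (suc s) = refl
    vanish : ∀ n (M : Mat (suc (suc n))) → (∀ i → M i zero ≈ M i (suc zero)) → ∀ j →
      sgF (suc (suc j)) * (M zero (suc (suc j)) * det (suc n) (λ r s → M (suc r) (punchIn (suc (suc j)) s))) ≈ 0#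
    vanish (suc n) M eq j = trans (*-congˡ (trans (*-congˡ (det-columns-equal n _ (λ i → eq (suc i)))) (zeroʳ _))) (zeroʳ _)

  det-rows-equal : ∀ n (M : Mat (suc (suc n))) → (∀ j → M zero j ≈ M (suc zero) j) → det (suc (suc n)) M ≈ 0#
  det-rows-equal n M eq = trans (det-transpose _ M) (det-columns-equal n (M ᵀ) eq)

  rows : ∀ {n} → (a b : Fin (suc (suc n)) → Carrier) → (Fin n → Fin (suc (suc n)) → Carrier) → Mat (suc (suc n))
  rows a b M zero          = a
  rows a b M (suc zero)    = b
  rows a b M (suc (suc i)) = M i

  -- Polarisation: the determinant with both rows equal to a + b vanishes, and bilinearity leaves
  -- the two mixed terms.
  det-swap : ∀ n a b (M : Fin n → Fin (suc (suc n)) → Carrier) →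
    det (suc (suc n)) (rows a b M) ≈ - det (suc (suc n)) (rows b a M)
  det-swap n a b M = begin
    d a b                              ≈⟨ solve 2 (λ x y → x := (:- y) :+ (x :+ y)) refl (d a b) (d b a) ⟩
    - d b a + (d a b + d b a)          ≈⟨ +-congˡ vanish ⟨
    - d b a + 0#                       ≈⟨ +-identityʳ _ ⟩
    - d b a                            ∎
    where
    d : (a b : Fin (suc (suc n)) → Carrier) → Carrier
    d a b = det (suc (suc n)) (rows a b M)
    a+b : Fin (suc (suc n)) → Carrier
    a+b j = a j + 1# * b j
    diag : ∀ a → d a a ≈ 0#
    diag a = det-rows-equal n (rows a a M) (λ j → refl)
    left : ∀ r → d a+b r ≈ d a r + 1# * d b r
    left r = det-row-linear zero 1# (λ j → refl) (λ { zero j → refl ; (suc i) j → refl }) (λ { zero j → refl ; (suc i) j → refl })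
    right : ∀ r → d r a+b ≈ d r a + 1# * d r b
    right r = det-row-linear (suc zero) 1# (λ j → refl) (λ { zero j → refl ; (suc i) j → refl }) (λ { zero j → refl ; (suc i) j → refl })
    vanish : 0# ≈ d a b + d b a
    vanish = begin
      0#                                                    ≈⟨ diag a+b ⟨
      d a+b a+b                                             ≈⟨ left a+b ⟩
      d a a+b + 1# * d b a+b                                ≈⟨ +-cong (right a) (*-congˡ (right b)) ⟩
      (d a a + 1# * d a b) + 1# * (d b a + 1# * d b b)      ≈⟨ +-cong (+-congʳ (diag a)) (*-congˡ (+-congˡ (*-congˡ (diag b)))) ⟩
      (0# + 1# * d a b) + 1# * (d b a + 1# * 0#)            ≈⟨ solve 2 (λ x y → (con (+ 0) :+ con (+ 1) :* x) :+ con (+ 1) :* (y :+ con (+ 1) :* con (+ 0)) := x :+ y) refl _ _ ⟩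
      d a b + d b a                                         ∎

  toFront : ∀ {n} → Fin (suc n) → Fin (suc n) → Fin (suc n)
  toFront v zero    = v
  toFront v (suc i) = punchIn v i

  lift : ∀ {n} → (Fin n → Fin n) → Fin (suc n) → Fin (suc n)
  lift f zero    = zero
  lift f (suc i) = suc (f i)

  det-rows-lift : ∀ n (f : Fin n → Fin n) ε → (∀ M → det n (λ i → M (f i)) ≈ ε * det n M) →
    ∀ M → det (suc n) (λ i → M (lift f i)) ≈ ε * det (suc n) M
  det-rows-lift n f ε scale M = trans (det-expand n _) (trans
    (∑-cong λ j → trans (*-congˡ {sgF j} (*-congˡ {M zero j} (scale (λ r s → M (suc r) (punchIn j s)))))
      (solve 4 (λ s m e d → s :* (m :* (e :* d)) := e :* (s :* (m :* d))) refl (sgF j) (M zero j) ε _))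
    (trans (sym (∑-* ε _)) (*-congˡ (sym (det-expand n M)))))

  -- Row `suc v` is brought to second place by induction below row `zero`, then one exchange brings
  -- it to the front: one sign for each place.
  det-rows-toFront : ∀ n (v : Fin (suc n)) M → det (suc n) (λ i → M (toFront v i)) ≈ sgF v * det (suc n) M
  det-rows-toFront n zero M = trans (det-cong (suc n) (λ { zero j → refl ; (suc i) j → refl })) (sym (*-identityˡ _))
  det-rows-toFront (suc n) (suc v) M = begin
    det (suc (suc n)) (λ i → M (toFront (suc v) i))
      ≈⟨ det-cong (suc (suc n)) (λ { zero j → refl ; (suc zero) j → refl ; (suc (suc i)) j → refl }) ⟩
    det (suc (suc n)) (rows (M (suc v)) (M zero) N)
      ≈⟨ det-swap n (M (suc v)) (M zero) N ⟩
    - det (suc (suc n)) (rows (M zero) (M (suc v)) N)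
      ≈⟨ -‿cong (det-cong (suc (suc n)) (λ { zero j → refl ; (suc zero) j → refl ; (suc (suc i)) j → refl })) ⟩
    - det (suc (suc n)) (λ i → M (lift (toFront v) i))
      ≈⟨ -‿cong (det-rows-lift (suc n) (toFront v) (sgF v) (det-rows-toFront n v) M) ⟩
    - (sgF v * det (suc (suc n)) M)
      ≈⟨ -‿distribˡ-* _ _ ⟩
    - sgF v * det (suc (suc n)) M ∎
    where
    N : Fin n → Fin (suc (suc n)) → Carrier
    N i = M (suc (punchIn v i))

  det-columns-toFront : ∀ n (v : Fin (suc n)) M → det (suc n) (λ i j → M i (toFront v j)) ≈ sgF v * det (suc n) M
  det-columns-toFront n v M = trans (det-transpose _ _)
    (trans (det-rows-toFront n v (M ᵀ)) (*-congˡ (sym (det-transpose _ M))))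

  module _ {n} (ι : Fin (suc n) → Fin (suc n)) (inj : Injective _≡_ _≡_ ι) where

    private
      distinct : ∀ i → ι zero ≢ ι (suc i)
      distinct i eq = 0≢1+n (inj eq)

    remainder : Fin n → Fin n
    remainder i = punchOut (distinct i)

    remainder-injective : Injective _≡_ _≡_ remainder
    remainder-injective {i} {j} eq = suc-injective (inj (punchOut-injective (distinct i) (distinct j) eq))

    -- Reduces an arbitrary permutation, given as an injective self-map, to one move to the front
    -- and a permutation of one index fewer.
    decompose : ∀ i → ι i ≡ toFront (ι zero) (lift remainder i)
    decompose zero    = ≡.refl
    decompose (suc i) = ≡.sym (punchIn-punchOut (distinct i))

  -- Only `ε * ε ≈ 1#` is recorded about the sign: in `det-reindex` it occurs once for the rows and
  -- once for the columns.
  reindexing-sign : ∀ n (ι : Fin n → Fin n) → Injective _≡_ _≡_ ι →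
    Σ Carrier λ ε → ε * ε ≈ 1# × (∀ M → det n (λ i → M (ι i)) ≈ ε * det n M)
  reindexing-sign zero    ι inj = 1# , *-identityˡ 1# , λ M → trans (det-cong zero λ ()) (sym (*-identityˡ _))
  reindexing-sign (suc n) ι inj with reindexing-sign n (remainder ι inj) (remainder-injective ι inj)
  ... | ε , ε² , scale = ε * sgF (ι zero) ,
    trans (solve 2 (λ a b → (a :* b) :* (a :* b) := (a :* a) :* (b :* b)) refl _ _)
      (trans (*-cong ε² (sg-square (toℕ (ι zero)))) (*-identityˡ 1#)) ,
    λ M → begin
      det (suc n) (λ i → M (ι i))
        ≈⟨ det-cong (suc n) (λ i j → reflexive (≡.cong (λ k → M k j) (decompose ι inj i))) ⟩
      det (suc n) (λ i → M (toFront (ι zero) (lift (remainder ι inj) i)))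
        ≈⟨ det-rows-lift n (remainder ι inj) ε scale (λ i → M (toFront (ι zero) i)) ⟩
      ε * det (suc n) (λ i → M (toFront (ι zero) i))
        ≈⟨ *-congˡ (det-rows-toFront n (ι zero) M) ⟩
      ε * (sgF (ι zero) * det (suc n) M)
        ≈⟨ *-assoc _ _ _ ⟨
      ε * sgF (ι zero) * det (suc n) M ∎

  det-reindex : ∀ n (ι : Fin n → Fin n) → Injective _≡_ _≡_ ι → ∀ M → det n (λ i j → M (ι i) (ι j)) ≈ det n M
  det-reindex n ι inj M with reindexing-sign n ι inj
  ... | ε , ε² , scale = begin
    det n (λ i j → M (ι i) (ι j))      ≈⟨ scale (λ i j → M i (ι j)) ⟩
    ε * det n (λ i j → M i (ι j))      ≈⟨ *-congˡ (det-transpose n _) ⟩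
    ε * det n (λ i j → M j (ι i))      ≈⟨ *-congˡ (scale (M ᵀ)) ⟩
    ε * (ε * det n (M ᵀ))              ≈⟨ *-assoc _ _ _ ⟨
    ε * ε * det n (M ᵀ)                ≈⟨ *-cong ε² (sym (det-transpose n M)) ⟩
    1# * det n M                       ≈⟨ *-identityˡ _ ⟩
    det n M                            ∎

  ∑-reindex : ∀ n (ι : Fin n → Fin n) → Injective _≡_ _≡_ ι → ∀ f → ∑ (λ i → f (ι i)) ≈ ∑ f
  ∑-reindex zero    ι inj f = ∑-cong λ ()
  ∑-reindex (suc n) ι inj f = begin
    ∑ (λ i → f (ι i))
      ≈⟨ ∑-suc _ ⟩
    f (ι zero) + ∑ (λ i → f (ι (suc i)))
      ≈⟨ +-congˡ (∑-cong (λ i → reflexive (≡.cong f (decompose ι inj (suc i))))) ⟩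
    f (ι zero) + ∑ (λ i → f (punchIn (ι zero) (remainder ι inj i)))
      ≈⟨ +-congˡ (∑-reindex n (remainder ι inj) (remainder-injective ι inj) (λ i → f (punchIn (ι zero) i))) ⟩
    f (ι zero) + ∑ (λ i → f (punchIn (ι zero) i))
      ≈⟨ ∑-remove (ι zero) f ⟨
    ∑ f ∎

  -- Once row `suc k` stands directly below row `zero`, linearity in row `zero` leaves `a` times a
  -- determinant with two equal rows. The square of `sgF k` is inserted to pay for the move.
  det-rows-dependent : ∀ n (k : Fin (suc n)) a (M : Mat (suc (suc n))) →
    (∀ j → M zero j ≈ a * M (suc k) j) → det (suc (suc n)) M ≈ 0#
  det-rows-dependent n k a M eq = begin
    det (suc (suc n)) M                         ≈⟨ solve 1 (λ d → d := con (+ 0) :+ d) refl _ ⟩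
    0# + det (suc (suc n)) M                    ≈⟨ +-congˡ (trans (sym (*-identityˡ _)) (*-congʳ (sym (sg-square (toℕ k))))) ⟩
    0# + (sgF k * sgF k) * det (suc (suc n)) M  ≈⟨ +-congˡ (*-assoc _ _ _) ⟩
    0# + sgF k * (sgF k * det (suc (suc n)) M)  ≈⟨ +-congˡ (*-congˡ (det-rows-lift (suc n) (toFront k) (sgF k) (det-rows-toFront n k) M)) ⟨
    0# + sgF k * det (suc (suc n)) N            ≈⟨ +-congˡ (*-congˡ zero-det) ⟩
    0# + sgF k * 0#                             ≈⟨ solve 1 (λ s → con (+ 0) :+ s :* con (+ 0) := con (+ 0)) refl _ ⟩
    0#                                          ∎
    where
    N : Mat (suc (suc n))
    N i = M (lift (toFront k) i)
    Z E : Mat (suc (suc n))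
    Z = rows (λ j → 0#) (N (suc zero)) (λ i → N (suc (suc i)))
    E = rows (N (suc zero)) (N (suc zero)) (λ i → N (suc (suc i)))
    Z≈0 : det (suc (suc n)) Z ≈ 0#
    Z≈0 = trans (det-expand (suc n) Z) (∑-vanish {f = λ j → sgF j * (0# * det (suc n) (λ r s → Z (suc r) (punchIn j s)))} (λ j → trans (*-congˡ (zeroˡ _)) (zeroʳ _)))
    zero-det : det (suc (suc n)) N ≈ 0#
    zero-det = begin
      det (suc (suc n)) N                            ≈⟨ det-row-linear zero a {Z} {E} {N} (λ j → trans (eq j) (sym (+-identityˡ _)))
                                                         (λ { zero j → refl ; (suc i) j → refl }) (λ { zero j → refl ; (suc i) j → refl }) ⟩
      det (suc (suc n)) Z + a * det (suc (suc n)) E  ≈⟨ +-cong Z≈0 (*-congˡ (det-rows-equal n E (λ j → refl))) ⟩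
      0# + a * 0#                                    ≈⟨ solve 1 (λ s → con (+ 0) :+ s :* con (+ 0) := con (+ 0)) refl _ ⟩
      0#                                             ∎

  det-neg : ∀ n (M : Mat n) → det n (λ i j → - M i j) ≈ sg n * det n M
  det-neg zero    M = trans (det-cong zero λ ()) (sym (*-identityˡ _))
  det-neg (suc n) M = trans (det-expand n _) (trans
    (∑-cong λ j → trans (*-congˡ {sgF j} (*-congˡ { - M zero j} (det-neg n (λ r s → M (suc r) (punchIn j s)))))
      (solve 4 (λ s m e d → s :* ((:- m) :* (e :* d)) := (:- e) :* (s :* (m :* d))) refl (sgF j) (M zero j) (sg n) _))
    (trans (sym (∑-* (- sg n) _)) (*-congˡ (sym (det-expand n M)))))

  row : ∀ {n} → (Fin (suc n) → Carrier) → (Fin n → Fin (suc n) → Carrier) → Mat (suc n)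
  row r M zero    = r
  row r M (suc i) = M i

  det-row-δ : ∀ n (k : Fin (suc n)) (M : Fin n → Fin (suc n) → Carrier) →
    det (suc n) (row (δ k) M) ≈ sgF k * det n (λ i j → M i (punchIn k j))
  det-row-δ n k M = trans (det-expand n _) (trans
    (∑-cong λ j → solve 3 (λ s d m → s :* (d :* m) := d :* (s :* m)) refl (sgF j) (δ k j) _)
    (∑-δ k (λ j → sgF j * det n (λ r s → M r (punchIn j s)))))

  -- The row δ₀ + σ δₖ is cleared to δ₀ by subtracting σ times column 0 from column k.
  det-eliminate : ∀ n (k : Fin n) σ (M : Fin n → Fin (suc n) → Carrier) →
    det (suc n) (row (λ j → δ zero j + σ * δ (suc k) j) M) ≈
    det n (λ i j → M i (suc j) + - σ * (δ k j * M i zero))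
  det-eliminate (suc n) k σ M = begin
    det (suc (suc n)) (row (λ j → δ zero j + σ * δ (suc k) j) M)
      ≈⟨ det-row-linear zero σ (λ j → refl) (λ i j → refl) (λ i j → refl) ⟩
    det (suc (suc n)) (row (δ zero) M) + σ * det (suc (suc n)) (row (δ (suc k)) M)
      ≈⟨ +-cong (trans (det-row-δ (suc n) zero M) (*-identityˡ _)) (*-congˡ (det-row-δ (suc n) (suc k) M)) ⟩
    det (suc n) N + σ * (- sgF k * det (suc n) (λ i j → M i (punchIn (suc k) j)))
      ≈⟨ +-congˡ (*-congˡ (*-congˡ moved)) ⟩
    det (suc n) N + σ * (- sgF k * (sgF k * det (suc n) Y))
      ≈⟨ +-congˡ (solve 3 (λ σ s d → σ :* ((:- s) :* (s :* d)) := (:- σ) :* ((s :* s) :* d)) refl σ (sgF k) _) ⟩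
    det (suc n) N + - σ * (sgF k * sgF k * det (suc n) Y)
      ≈⟨ +-congˡ (*-congˡ (trans (*-congʳ (sg-square (toℕ k))) (*-identityˡ _))) ⟩
    det (suc n) N + - σ * det (suc n) Y
      ≈⟨ +-cong (det-transpose _ N) (*-congˡ (det-transpose _ Y)) ⟩
    det (suc n) (N ᵀ) + - σ * det (suc n) (Y ᵀ)
      ≈⟨ det-row-linear k (- σ) {N ᵀ} {Y ᵀ} {X ᵀ} (λ i → +-congˡ (*-congˡ (at-k i))) (λ j i → sym (off-k j i)) (λ j i → off-k′ j i) ⟨
    det (suc n) (X ᵀ)
      ≈⟨ det-transpose _ X ⟨
    det (suc n) X ∎
    where
    N Y X : Mat (suc n)
    N i j = M i (suc j)
    -- `Y` is `N` with column `k` replaced by column `zero` of `M`. Moving that column to the front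
    -- gives the minor of `M` that omits column `suc k`.
    Y i j = M i (suc j) + δ k j * (M i zero - M i (suc j))
    X i j = M i (suc j) + - σ * (δ k j * M i zero)
    Y-at-k : ∀ i → Y i k ≈ M i zero
    Y-at-k i = trans (+-congˡ (*-congʳ (δ-diag k))) (solve 2 (λ a b → b :+ con (+ 1) :* (a :- b) := a) refl (M i zero) _)
    at-k : ∀ i → δ k k * M i zero ≈ Y i k
    at-k i = trans (trans (*-congʳ (δ-diag k)) (*-identityˡ _)) (sym (Y-at-k i))
    Y-off-k : ∀ j i → Y i (punchIn k j) ≈ N i (punchIn k j)
    Y-off-k j i = trans (+-congˡ (*-congʳ (δ-punchIn k j))) (solve 2 (λ a b → b :+ con (+ 0) :* a := b) refl _ _)
    off-k : ∀ j i → X i (punchIn k j) ≈ N i (punchIn k j)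
    off-k j i = trans (+-congˡ (*-congˡ (*-congʳ (δ-punchIn k j)))) (solve 3 (λ s a b → b :+ (:- s) :* (con (+ 0) :* a) := b) refl σ _ _)
    off-k′ : ∀ j i → Y i (punchIn k j) ≈ X i (punchIn k j)
    off-k′ j i = trans (Y-off-k j i) (sym (off-k j i))
    moved : det (suc n) (λ i j → M i (punchIn (suc k) j)) ≈ sgF k * det (suc n) Y
    moved = trans (det-cong (suc n) (λ { i zero → sym (Y-at-k i) ; i (suc j) → sym (Y-off-k j i) })) (det-columns-toFront n k Y)

-- Weighted signless Laplacians: pendent vertices, signed closing edges, deletion and contraction.

module Laplacian {c ℓ} (R : CommutativeRing c ℓ) where
  open CommutativeRing R hiding (zero)
  open import Relation.Binary.Reasoning.Setoid setoid
  open IntegerSolver R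
  open Determinant R

  δ-transport : ∀ {n} (k i : Fin n) (f : Fin n → Carrier) → δ k i * f i ≈ δ k i * f k
  δ-transport zero    zero    f = refl
  δ-transport zero    (suc i) f = trans (zeroˡ _) (sym (zeroˡ _))
  δ-transport (suc k) zero    f = trans (zeroˡ _) (sym (zeroˡ _))
  δ-transport (suc k) (suc i) f = δ-transport k i (λ j → f (suc j))

  δ-diagonal : ∀ {n} (u i j : Fin n) → δ u i * δ u j ≈ δ i j * δ u i
  δ-diagonal u i j = trans (sym (δ-transport u i (λ i → δ i j))) (*-comm _ _)

  bump : ∀ {n} → Carrier → Fin n → Mat n → Mat n
  bump w u N i j = N i j + w * (δ u i * δ u j)

  -- The new pendent vertex takes index `zero`, where row expansion and elimination remove it again.
  attach : ∀ {n} → Carrier → Fin n → Mat n → Mat (suc n)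
  attach w u N zero    zero    = w + 1#
  attach w u N zero    (suc j) = δ u j
  attach w u N (suc i) zero    = δ u i
  attach w u N (suc i) (suc j) = N i j + δ u i * δ u j

  -- Row `u` becomes `δ u`; the determinant is then the principal minor omitting `u`, which is the
  -- derivative of `det n N` in its diagonal entry at `u`.
  rowδ : ∀ {n} → Fin n → Mat n → Mat n
  rowδ u N i j = N i j + δ u i * (δ u j - N i j)

  det-bump : ∀ n w u (N : Mat n) → det n (bump w u N) ≈ det n N + w * det n (rowδ u N)
  det-bump (suc n) w u N = det-row-linear u w {N} {rowδ u N} {bump w u N}
    (λ j → trans (+-congˡ (*-congˡ (*-congʳ (δ-diag u))))
      (trans (solve 3 (λ w a b → a :+ w :* (con (+ 1) :* b) := a :+ w :* (a :+ con (+ 1) :* (b :- a))) refl w (N u j) (δ u j))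
             (sym (+-congˡ (*-congˡ (+-congˡ (*-congʳ (δ-diag u))))))))
    (λ i j → sym (trans (+-congˡ (*-congˡ (*-congʳ (δ-punchIn u i))))
      (solve 3 (λ w a b → a :+ w :* (con (+ 0) :* b) := a) refl w _ _)))
    (λ i j → trans (+-congˡ (*-congʳ (δ-punchIn u i)))
      (trans (solve 3 (λ w a b → a :+ con (+ 0) :* (b :- a) := a :+ w :* (con (+ 0) :* b)) refl w _ _)
             (sym (+-congˡ (*-congˡ (*-congʳ (δ-punchIn u i)))))))

  -- The first row is the edge vector plus w times `δ zero`. Elimination along the edge restores
  -- `N`, while striking out the vertex leaves `N` with 1 added at `u`. With d the derivative at
  -- `u`, the sum det N + w (det N + d) regroups into w det N + (det N + w d).
  det-attach : ∀ n w u (N : Mat n) → det (suc n) (attach w u N) ≈ w * det n N + det n (bump w u N)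
  det-attach n w u N = begin
    det (suc n) (attach w u N)
      ≈⟨ det-row-linear zero w {row (λ j → δ zero j + 1# * δ (suc u) j) rest} {row (δ zero) rest} {attach w u N}
           (λ { zero → solve 1 (λ w → w :+ con (+ 1) := con (+ 1) :+ con (+ 1) :* con (+ 0) :+ w :* con (+ 1)) refl w
              ; (suc j) → solve 2 (λ w d → d := con (+ 0) :+ con (+ 1) :* d :+ w :* con (+ 0)) refl w (δ u j) })
           (λ i j → refl) (λ i j → refl) ⟩
    det (suc n) (row (λ j → δ zero j + 1# * δ (suc u) j) rest) + w * det (suc n) (row (δ zero) rest)
      ≈⟨ +-cong (det-eliminate n u 1# rest) (*-congˡ (trans (det-row-δ n zero rest) (*-identityˡ _))) ⟩
    det n (λ i j → rest i (suc j) + - 1# * (δ u j * rest i zero)) + w * det n (λ i j → rest i (suc j))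
      ≈⟨ +-cong (det-cong n (λ i j → solve 3 (λ a d e → a :+ d :* e :+ (:- con (+ 1)) :* (e :* d) := a) refl (N i j) (δ u i) (δ u j)))
                (*-congˡ (det-cong n (λ i j → +-congˡ (sym (*-identityˡ _))))) ⟩
    det n N + w * det n (bump 1# u N)
      ≈⟨ +-congˡ (*-congˡ (det-bump n 1# u N)) ⟩
    det n N + w * (det n N + 1# * det n (rowδ u N))
      ≈⟨ solve 3 (λ w a b → a :+ w :* (a :+ con (+ 1) :* b) := w :* a :+ (a :+ w :* b)) refl w _ _ ⟩
    w * det n N + (det n N + w * det n (rowδ u N))
      ≈⟨ +-congˡ (det-bump n w u N) ⟨
    w * det n N + det n (bump w u N) ∎
    where
    rest : Fin n → Fin (suc n) → Carrier
    rest i = attach w u N (suc i)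

  -- A signed edge between `zero` and `k` as a rank-one update: `σ` equal to 1 is an edge of the
  -- signless Laplacian, -1 an edge of the ordinary Laplacian.
  close : ∀ {n} → Carrier → Fin (suc n) → Mat (suc n) → Mat (suc n)
  close σ k M i j = M i j + (δ zero i + σ * δ k i) * (δ zero j + σ * δ k j)

  module _ n (k : Fin (suc n)) (σ : Carrier) (σ² : σ * σ ≈ 1#) (w : Carrier) (N : Mat (suc (suc n))) where

    private
      κ : Fin (suc (suc n))
      κ = suc k

      Vector : Set c
      Vector = Fin (suc (suc n)) → Carrier

      -- N with row 0 replaced by r and row κ by s.
      replace : Vector → Vector → Mat (suc (suc n))
      replace r s zero    j = r j
      replace r s (suc i) j = N (suc i) j + δ k i * (s j - N (suc i) j)

      g : Vector → Vector → Carrier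
      g r s = det (suc (suc n)) (replace r s)

      _⊕_ : Vector → Vector → Vector
      (r ⊕ s) j = r j + s j

      _⊙_ : Carrier → Vector → Vector
      (a ⊙ r) j = a * r j

      replace-κ : ∀ r s j → replace r s κ j ≈ s j
      replace-κ r s j = trans (+-congˡ (*-congʳ (δ-diag k))) (solve 2 (λ a b → b :+ con (+ 1) :* (a :- b) := a) refl (s j) _)

      replace-off : ∀ r s i j → replace r s (suc (punchIn k i)) j ≈ N (suc (punchIn k i)) j
      replace-off r s i j = trans (+-congˡ (*-congʳ (δ-punchIn k i))) (solve 2 (λ a b → b :+ con (+ 0) :* a := b) refl _ _)

      g-linearˡ : ∀ r a r′ s → g (r ⊕ (a ⊙ r′)) s ≈ g r s + a * g r′ s
      g-linearˡ r a r′ s = det-row-linear zero a {replace r s} {replace r′ s} {replace (r ⊕ (a ⊙ r′)) s}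
        (λ j → refl) (λ i j → refl) (λ i j → refl)

      off : ∀ r s s′ i j → replace r s (punchIn κ i) j ≈ replace r s′ (punchIn κ i) j
      off r s s′ zero    j = refl
      off r s s′ (suc i) j = trans (replace-off r s i j) (sym (replace-off r s′ i j))

      g-linearʳ : ∀ r s a s′ → g r (s ⊕ (a ⊙ s′)) ≈ g r s + a * g r s′
      g-linearʳ r s a s′ = det-row-linear κ a {replace r s} {replace r s′} {replace r (s ⊕ (a ⊙ s′))}
        (λ j → trans (replace-κ r (s ⊕ (a ⊙ s′)) j) (sym (+-cong (replace-κ r s j) (*-congˡ (replace-κ r s′ j)))))
        (off r s (s ⊕ (a ⊙ s′))) (off r s′ (s ⊕ (a ⊙ s′)))

      g-dependent : ∀ r a s → (∀ j → r j ≈ a * s j) → g r s ≈ 0#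
      g-dependent r a s eq = det-rows-dependent n k a (replace r s) (λ j → trans (eq j) (*-congˡ (sym (replace-κ r s j))))

      N₀ Nκ e₀ eκ v z : Vector
      N₀ = N zero
      Nκ = N κ
      e₀ = δ zero
      eκ = δ κ
      -- Both `v` and `z` are multiples of the contracted edge vector: since σ² = 1, `v` is -σ times
      -- `z`, so `g v z` vanishes.
      v = e₀ ⊕ ((- σ) ⊙ eκ)
      z = eκ ⊕ ((- σ) ⊙ e₀)

      fromSum : ∀ (M : Mat (suc (suc n))) r t → (∀ j → M zero j ≈ r j) → (∀ i j → M (suc i) j ≈ N (suc i) j + δ k i * t j) →
        det (suc (suc n)) M ≈ g r (Nκ ⊕ t)
      fromSum M r t eq₀ eq = det-cong (suc (suc n)) λ
        { zero    j → eq₀ j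
        ; (suc i) j → trans (eq i j) (trans
            (trans (solve 3 (λ a d t → a :+ d :* t := a :+ (d :* a :+ d :* (t :- a))) refl (N (suc i) j) (δ k i) (t j))
                   (+-congˡ (+-congʳ (δ-transport k i (λ i → N (suc i) j)))))
            (solve 4 (λ a b d t → a :+ (d :* b :+ d :* (t :- a)) := a :+ d :* (b :+ t :- a)) refl (N (suc i) j) (Nκ j) (δ k i) (t j))) }

      zeroV : Vector
      zeroV j = 0#

      g-cong : ∀ {r r′ s s′} → (∀ j → r j ≈ r′ j) → (∀ j → s j ≈ s′ j) → g r s ≈ g r′ s′
      g-cong {r} {r′} {s} {s′} eq eq′ = det-cong (suc (suc n)) λ
        { zero j → eq j ; (suc i) j → +-congˡ (*-congˡ (+-congʳ (eq′ j))) }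

      one : ∀ (r s : Vector) j → r j + s j ≈ r j + 1# * s j
      one r s j = +-congˡ (sym (*-identityˡ _))

      -- `X₁`, `X₂` and `X₃` treat the three parts of the first row of the closed matrix:
      -- elimination of the new vertex along its edge to `zero`, elimination along the closing edge,
      -- and striking the vertex out for its weight.
      X₁ : det (suc (suc n)) (λ i j → N i j + δ κ i * z j) ≈ g N₀ Nκ + g N₀ z
      X₁ = begin
        det (suc (suc n)) (λ i j → N i j + δ κ i * z j)
          ≈⟨ fromSum _ N₀ z (λ j → trans (+-congˡ (zeroˡ _)) (+-identityʳ _)) (λ i j → refl) ⟩
        g N₀ (Nκ ⊕ z)             ≈⟨ g-cong (λ j → refl) (one Nκ z) ⟩
        g N₀ (Nκ ⊕ (1# ⊙ z))      ≈⟨ g-linearʳ N₀ Nκ 1# z ⟩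
        g N₀ Nκ + 1# * g N₀ z     ≈⟨ +-congˡ (*-identityˡ _) ⟩
        g N₀ Nκ + g N₀ z          ∎

      X₂ : det (suc (suc n)) (λ i j → N i j + δ zero i * v j) ≈ g (N₀ ⊕ v) Nκ
      X₂ = trans (fromSum _ (N₀ ⊕ v) zeroV (λ j → +-congˡ (*-identityˡ _)) (λ i j → +-congˡ (trans (zeroˡ _) (sym (zeroʳ _)))))
        (g-cong (λ j → refl) (λ j → +-identityʳ _))

      X₃ : det (suc (suc n)) (λ i j → N i j + δ zero i * e₀ j + δ κ i * eκ j) ≈ (g N₀ Nκ + g e₀ Nκ) + (g N₀ eκ + g e₀ eκ)
      X₃ = begin
        det (suc (suc n)) (λ i j → N i j + δ zero i * e₀ j + δ κ i * eκ j)
          ≈⟨ fromSum _ (N₀ ⊕ (1# ⊙ e₀)) (1# ⊙ eκ)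
               (λ j → solve 3 (λ a b c → a :+ con (+ 1) :* b :+ con (+ 0) :* c := a :+ con (+ 1) :* b) refl _ _ _)
               (λ i j → solve 4 (λ a b c d → a :+ con (+ 0) :* b :+ c :* d := a :+ c :* (con (+ 1) :* d)) refl _ (e₀ j) _ _) ⟩
        g (N₀ ⊕ (1# ⊙ e₀)) (Nκ ⊕ (1# ⊙ eκ))
          ≈⟨ g-linearʳ (N₀ ⊕ (1# ⊙ e₀)) Nκ 1# eκ ⟩
        g (N₀ ⊕ (1# ⊙ e₀)) Nκ + 1# * g (N₀ ⊕ (1# ⊙ e₀)) eκ
          ≈⟨ +-cong (g-linearˡ N₀ 1# e₀ Nκ) (*-congˡ (g-linearˡ N₀ 1# e₀ eκ)) ⟩
        (g N₀ Nκ + 1# * g e₀ Nκ) + 1# * (g N₀ eκ + 1# * g e₀ eκ)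
          ≈⟨ solve 4 (λ a b c d → (a :+ con (+ 1) :* b) :+ con (+ 1) :* (c :+ con (+ 1) :* d) := (a :+ b) :+ (c :+ d)) refl _ _ _ _ ⟩
        (g N₀ Nκ + g e₀ Nκ) + (g N₀ eκ + g e₀ eκ) ∎

      N≈ : det (suc (suc n)) N ≈ g N₀ Nκ
      N≈ = trans (fromSum N N₀ zeroV (λ j → refl) (λ i j → sym (trans (+-congˡ (zeroʳ _)) (+-identityʳ _))))
        (g-cong (λ j → refl) (λ j → +-identityʳ _))

      bumped : det (suc (suc n)) (bump w zero N) ≈ g N₀ Nκ + w * g e₀ Nκ
      bumped = trans (trans (fromSum _ (N₀ ⊕ (w ⊙ e₀)) zeroV
          (λ j → +-congˡ (*-congˡ (*-identityˡ _)))
          (λ i j → solve 4 (λ a w b c → a :+ w :* (con (+ 0) :* b) := a :+ c :* con (+ 0)) refl _ w (e₀ j) (δ k i)))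
        (g-cong (λ j → refl) (λ j → +-identityʳ _)))
        (g-linearˡ N₀ w e₀ Nκ)

      -- In the contracted matrix row `zero` gains `v`, and row `κ` gains w `eκ` + `z`, again by σ²
      -- = 1. These are the terms left of `X₁`, `X₂` and `X₃` once those of the deleted matrix are
      -- removed.
      Y : det (suc (suc n)) (close (- σ) κ (bump w κ N)) ≈ g (N₀ ⊕ v) Nκ + (w * (g N₀ eκ + g e₀ eκ) + g N₀ z)
      Y = begin
        det (suc (suc n)) (close (- σ) κ (bump w κ N))
          ≈⟨ fromSum _ (N₀ ⊕ v) ((w ⊙ eκ) ⊕ (1# ⊙ z))
               (λ j → solve 5 (λ a w s b c → (a :+ w :* (con (+ 0) :* c)) :+ (con (+ 1) :+ (:- s) :* con (+ 0)) :* (b :+ (:- s) :* c) := a :+ (b :+ (:- s) :* c)) refl (N₀ j) w σ (e₀ j) (eκ j))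
               (λ i j → trans
                  (solve 6 (λ a w s b c d → (a :+ w :* (d :* c)) :+ (con (+ 0) :+ (:- s) :* d) :* (b :+ (:- s) :* c) := a :+ d :* (w :* c :+ (s :* s :* c :+ (:- s) :* b)))
                    refl (N (suc i) j) w σ (e₀ j) (eκ j) (δ k i))
                  (+-congˡ (*-congˡ (+-congˡ (trans (+-congʳ (*-congʳ σ²)) (solve 3 (λ s b c → con (+ 1) :* c :+ (:- s) :* b := con (+ 1) :* (c :+ (:- s) :* b)) refl σ (e₀ j) (eκ j))))))) ⟩
        g (N₀ ⊕ v) (Nκ ⊕ ((w ⊙ eκ) ⊕ (1# ⊙ z)))
          ≈⟨ g-cong (λ j → refl) (λ j → sym (+-assoc _ _ _)) ⟩
        g (N₀ ⊕ v) ((Nκ ⊕ (w ⊙ eκ)) ⊕ (1# ⊙ z))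
          ≈⟨ g-linearʳ (N₀ ⊕ v) (Nκ ⊕ (w ⊙ eκ)) 1# z ⟩
        g (N₀ ⊕ v) (Nκ ⊕ (w ⊙ eκ)) + 1# * g (N₀ ⊕ v) z
          ≈⟨ +-cong (g-linearʳ (N₀ ⊕ v) Nκ w eκ) (*-congˡ (left z)) ⟩
        (g (N₀ ⊕ v) Nκ + w * g (N₀ ⊕ v) eκ) + 1# * (g N₀ z + g v z)
          ≈⟨ +-cong (+-congˡ (*-congˡ (trans (left eκ) (+-congˡ v-eκ)))) (*-congˡ (+-congˡ (g-dependent v (- σ) z v≈))) ⟩
        (g (N₀ ⊕ v) Nκ + w * (g N₀ eκ + g e₀ eκ)) + 1# * (g N₀ z + 0#)
          ≈⟨ solve 5 (λ a w b c d → (a :+ w :* (b :+ c)) :+ con (+ 1) :* (d :+ con (+ 0)) := a :+ (w :* (b :+ c) :+ d)) refl _ w _ _ _ ⟩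
        g (N₀ ⊕ v) Nκ + (w * (g N₀ eκ + g e₀ eκ) + g N₀ z) ∎
        where
        left : ∀ s → g (N₀ ⊕ v) s ≈ g N₀ s + g v s
        left s = trans (g-cong (one N₀ v) (λ j → refl)) (trans (g-linearˡ N₀ 1# v s) (+-congˡ (*-identityˡ _)))
        v-eκ : g v eκ ≈ g e₀ eκ
        v-eκ = trans (g-linearˡ e₀ (- σ) eκ eκ) (trans (+-congˡ (trans (*-congˡ (g-dependent eκ 1# eκ (λ j → sym (*-identityˡ _)))) (zeroʳ _))) (+-identityʳ _))
        v≈ : ∀ j → v j ≈ - σ * z j
        v≈ j = trans (trans (+-congʳ (trans (sym (*-identityˡ _)) (*-congʳ (sym σ²)))) (solve 3 (λ s b c → s :* s :* b :+ (:- s) :* c := (:- s) :* (c :+ (:- s) :* b)) refl σ (e₀ j) (eκ j))) refl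

    -- Deletion and contraction of the edge joining 0 to k; contracting it flips the sign of the other edge at 0.
    det-close : det (suc (suc (suc n))) (close σ (suc κ) (attach w zero N)) ≈
      det (suc (suc (suc n))) (attach w zero N) + det (suc (suc n)) (close (- σ) κ (bump w κ N))
    det-close = begin
      det (suc (suc (suc n))) (close σ (suc κ) (attach w zero N))
        ≈⟨ det-row-linear zero 1# {row r₁₃ rest} {row (λ j → δ zero j + σ * δ (suc κ) j) rest} {close σ (suc κ) (attach w zero N)}
             (λ { zero → solve 2 (λ w s → (w :+ con (+ 1)) :+ (con (+ 1) :+ s :* con (+ 0)) :* (con (+ 1) :+ s :* con (+ 0)) := ((con (+ 1) :+ con (+ 1) :* con (+ 0)) :+ w :* con (+ 1)) :+ con (+ 1) :* (con (+ 1) :+ s :* con (+ 0))) refl w σ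
                ; (suc j) → solve 4 (λ w s a b → a :+ (con (+ 1) :+ s :* con (+ 0)) :* (con (+ 0) :+ s :* b) := ((con (+ 0) :+ con (+ 1) :* a) :+ w :* con (+ 0)) :+ con (+ 1) :* (con (+ 0) :+ s :* b)) refl w σ (δ zero j) (δ κ j) })
             (λ i j → refl) (λ i j → refl) ⟩
      det (suc (suc (suc n))) (row r₁₃ rest) + 1# * det (suc (suc (suc n))) (row (λ j → δ zero j + σ * δ (suc κ) j) rest)
        ≈⟨ +-cong (det-row-linear zero w {row (λ j → δ zero j + 1# * δ (suc zero) j) rest} {row (δ zero) rest} {row r₁₃ rest} (λ j → refl) (λ i j → refl) (λ i j → refl))
                  (*-congˡ (trans (det-eliminate (suc (suc n)) κ σ rest) (det-cong (suc (suc n)) eq₂))) ⟩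
      (det (suc (suc (suc n))) (row (λ j → δ zero j + 1# * δ (suc zero) j) rest) + w * det (suc (suc (suc n))) (row (δ zero) rest))
          + 1# * det (suc (suc n)) (λ i j → N i j + δ zero i * v j)
        ≈⟨ +-cong (+-cong (trans (det-eliminate (suc (suc n)) zero 1# rest) (trans (det-cong (suc (suc n)) eq₁) X₁))
                          (*-congˡ (trans (trans (det-row-δ (suc (suc n)) zero rest) (*-identityˡ _)) (trans (det-cong (suc (suc n)) eq₃) X₃)))) (*-congˡ X₂) ⟩
      ((g N₀ Nκ + g N₀ z) + w * ((g N₀ Nκ + g e₀ Nκ) + (g N₀ eκ + g e₀ eκ))) + 1# * g (N₀ ⊕ v) Nκ
        ≈⟨ solve 7 (λ w a b c d e f → ((a :+ b) :+ w :* ((a :+ c) :+ (d :+ e))) :+ con (+ 1) :* f := (w :* a :+ (a :+ w :* c)) :+ (f :+ (w :* (d :+ e) :+ b))) refl w _ _ _ _ _ _ ⟩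
      (w * g N₀ Nκ + (g N₀ Nκ + w * g e₀ Nκ)) + (g (N₀ ⊕ v) Nκ + (w * (g N₀ eκ + g e₀ eκ) + g N₀ z))
        ≈⟨ +-cong (trans (det-attach (suc (suc n)) w zero N) (+-cong (*-congˡ N≈) bumped)) Y ⟨
      det (suc (suc (suc n))) (attach w zero N) + det (suc (suc n)) (close (- σ) κ (bump w κ N)) ∎
      where
      rest : Fin (suc (suc n)) → Fin (suc (suc (suc n))) → Carrier
      rest i = close σ (suc κ) (attach w zero N) (suc i)
      r₁₃ : Fin (suc (suc (suc n))) → Carrier
      r₁₃ j = (δ zero j + 1# * δ (suc zero) j) + w * δ zero j
      eq₁ : ∀ i j → rest i (suc j) + - 1# * (δ zero j * rest i zero) ≈ N i j + δ κ i * z j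
      eq₁ i j = trans
        (solve 6 (λ a s p q b c → (a :+ p :* b :+ (con (+ 0) :+ s :* q) :* (con (+ 0) :+ s :* c)) :+ (:- con (+ 1)) :* (b :* (p :+ (con (+ 0) :+ s :* q) :* (con (+ 1) :+ s :* con (+ 0)))) := a :+ q :* (s :* s :* c :+ (:- s) :* b))
          refl (N i j) σ (δ zero i) (δ κ i) (δ zero j) (δ κ j))
        (+-congˡ (*-congˡ (+-congʳ (trans (*-congʳ σ²) (*-identityˡ _)))))
      eq₂ : ∀ i j → rest i (suc j) + - σ * (δ κ j * rest i zero) ≈ N i j + δ zero i * v j
      eq₂ i j =
        solve 6 (λ a s p q b c → (a :+ p :* b :+ (con (+ 0) :+ s :* q) :* (con (+ 0) :+ s :* c)) :+ (:- s) :* (c :* (p :+ (con (+ 0) :+ s :* q) :* (con (+ 1) :+ s :* con (+ 0)))) := a :+ p :* (b :+ (:- s) :* c))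
          refl (N i j) σ (δ zero i) (δ κ i) (δ zero j) (δ κ j)
      eq₃ : ∀ i j → rest i (suc j) ≈ N i j + δ zero i * e₀ j + δ κ i * eκ j
      eq₃ i j = trans
        (solve 6 (λ a s p q b c → (a :+ p :* b :+ (con (+ 0) :+ s :* q) :* (con (+ 0) :+ s :* c)) := a :+ p :* b :+ s :* s :* (q :* c))
          refl (N i j) σ (δ zero i) (δ κ i) (δ zero j) (δ κ j))
        (+-congˡ (trans (*-congʳ σ²) (*-identityˡ _)))

  -- Here `g` is any matrix over the ring, so that `lap` can also be applied to the difference of
  -- two adjacency matrices.
  lap : ∀ {n} → (Fin n → Carrier) → Mat n → Mat n
  lap w g i j = δ i j * (w i + ∑ (g i)) + g i j

  lap-cong : ∀ {n} {w w′ : Fin n → Carrier} {g g′ : Mat n} → (∀ i → w i ≈ w′ i) → (∀ i j → g i j ≈ g′ i j) →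
    ∀ i j → lap w g i j ≈ lap w′ g′ i j
  lap-cong w≈w′ g≈g′ i j = +-cong (*-congˡ (+-cong (w≈w′ i) (∑-cong (g≈g′ i)))) (g≈g′ i j)

  δ-injective : ∀ {m n} (ι : Fin m → Fin n) → Injective _≡_ _≡_ ι → ∀ i j → δ (ι i) (ι j) ≈ δ i j
  δ-injective ι inj i j with i ≟ j
  ... | yes ≡.refl = trans (δ-diag (ι i)) (sym (δ-diag i))
  ... | no i≢j     = trans (δ-off (λ eq → i≢j (inj eq))) (sym (δ-off i≢j))

  det-lap-reindex : ∀ n (ι : Fin n → Fin n) → Injective _≡_ _≡_ ι → ∀ w g →
    det n (lap (λ i → w (ι i)) (λ i j → g (ι i) (ι j))) ≈ det n (lap w g)
  det-lap-reindex n ι inj w g = trans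
    (det-cong n (λ i j → +-congʳ (*-cong (sym (δ-injective ι inj i j)) (+-congˡ (∑-reindex n ι inj (g (ι i)))))))
    (det-reindex n ι inj (lap w g))

  attachGraph : ∀ {n} → Fin n → Mat n → Mat (suc n)
  attachGraph u g zero    zero    = 0#
  attachGraph u g zero    (suc j) = δ u j
  attachGraph u g (suc i) zero    = δ u i
  attachGraph u g (suc i) (suc j) = g i j

  lap-attach : ∀ {n} w u (g : Mat n) i j → lap w (attachGraph u g) i j ≈ attach (w zero) u (lap (λ i → w (suc i)) g) i j
  lap-attach w u g zero zero = trans (+-congʳ (*-congˡ (+-congˡ (trans (∑-suc _)
      (+-congˡ (∑-δ-1 u))))))
    (solve 1 (λ w → con (+ 1) :* (w :+ (con (+ 0) :+ con (+ 1))) :+ con (+ 0) := w :+ con (+ 1)) refl (w zero))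
  lap-attach w u g zero (suc j) = trans (+-congʳ (zeroˡ _)) (+-identityˡ _)
  lap-attach w u g (suc i) zero = trans (+-congʳ (zeroˡ _)) (+-identityˡ _)
  lap-attach w u g (suc i) (suc j) = trans (+-congʳ (*-congˡ (+-congˡ (∑-suc _))))
    (trans (solve 5 (λ d w e s a → d :* (w :+ (e :+ s)) :+ a := (d :* (w :+ s) :+ a) :+ d :* e) refl (δ i j) (w (suc i)) (δ u i) (∑ (g i)) (g i j))
           (+-congˡ (sym (δ-diagonal u i j))))

  lap-bump : ∀ {n} t u w (g : Mat n) i j → bump t u (lap w g) i j ≈ lap (λ i → w i + t * δ u i) g i j
  lap-bump t u w g i j = trans (+-congˡ (*-congˡ (δ-diagonal u i j)))
    (solve 6 (λ d w s a t e → d :* (w :+ s) :+ a :+ t :* (d :* e) := d :* (w :+ t :* e :+ s) :+ a) refl (δ i j) (w i) (∑ (g i)) (g i j) t (δ u i))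

  det-lap-attach : ∀ n w u (g : Mat n) → det (suc n) (lap w (attachGraph u g)) ≈
    w zero * det n (lap (λ i → w (suc i)) g) + det n (lap (λ i → w (suc i) + w zero * δ u i) g)
  det-lap-attach n w u g = trans (det-cong (suc n) (lap-attach w u g))
    (trans (det-attach n (w zero) u (lap (λ i → w (suc i)) g)) (+-congˡ (det-cong n (lap-bump (w zero) u (λ i → w (suc i)) g))))

-- Positive cones; nonnegativity and monotonicity of determinants.

record PositiveCone {c ℓ} (R : CommutativeRing c ℓ) p : Set (c ⊔ ℓ ⊔ Level.suc p) where
  open CommutativeRing R
  field
    NonNeg      : Carrier → Set p
    nonNeg-resp : ∀ {a b} → a ≈ b → NonNeg a → NonNeg b
    nonNeg-0    : NonNeg 0#
    nonNeg-1    : NonNeg 1#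
    nonNeg-+    : ∀ {a b} → NonNeg a → NonNeg b → NonNeg (a + b)
    nonNeg-*    : ∀ {a b} → NonNeg a → NonNeg b → NonNeg (a * b)

module Positivity {c ℓ p} (R : CommutativeRing c ℓ) (P : PositiveCone R p) where
  open CommutativeRing R hiding (zero)
  open PositiveCone P
  open import Algebra.Properties.Ring ring using (-‿involutive)
  open import Relation.Binary.Reasoning.Setoid setoid
  open IntegerSolver R
  open Determinant R
  open Laplacian R

  infix 4 _⊑_

  _⊑_ : Carrier → Carrier → Set p
  a ⊑ b = NonNeg (b - a)

  ⊑-refl : ∀ {a} → a ⊑ a
  ⊑-refl {a} = nonNeg-resp (sym (-‿inverseʳ a)) nonNeg-0

  0⊑ : ∀ {a} → NonNeg a → 0# ⊑ a
  0⊑ = nonNeg-resp (solve 1 (λ a → a := a :- con (+ 0)) refl _)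

  ⊑-trans : ∀ {a b d} → a ⊑ b → b ⊑ d → a ⊑ d
  ⊑-trans {a} {b} {d} a⊑b b⊑d = nonNeg-resp (solve 3 (λ a b d → (b :- a) :+ (d :- b) := d :- a) refl a b d) (nonNeg-+ a⊑b b⊑d)

  ⊑-resp : ∀ {a a′ b b′} → a ≈ a′ → b ≈ b′ → a ⊑ b → a′ ⊑ b′
  ⊑-resp a≈a′ b≈b′ = nonNeg-resp (+-cong b≈b′ (-‿cong a≈a′))

  ⊑-+ : ∀ {a b a′ b′} → a ⊑ b → a′ ⊑ b′ → a + a′ ⊑ b + b′
  ⊑-+ {a} {b} {a′} {b′} p q = nonNeg-resp (solve 4 (λ a b c d → (b :- a) :+ (d :- c) := (b :+ d) :- (a :+ c)) refl a b a′ b′) (nonNeg-+ p q)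

  ⊑-*ˡ : ∀ {x a b} → NonNeg x → a ⊑ b → x * a ⊑ x * b
  ⊑-*ˡ {x} {a} {b} x≥0 p = nonNeg-resp (solve 3 (λ x a b → x :* (b :- a) := x :* b :- x :* a) refl x a b) (nonNeg-* x≥0 p)

  ⊑-by : ∀ {a b} d → NonNeg d → b ≈ a + d → a ⊑ b
  ⊑-by {a} d d≥0 eq = nonNeg-resp (trans (solve 2 (λ a d → d := (a :+ d) :- a) refl a d) (+-congʳ (sym eq))) d≥0

  Unit : Carrier → Set ℓ
  Unit σ = σ ≈ 1# ⊎ σ ≈ - 1#

  unit-neg-* : ∀ {σ τ} → Unit σ → Unit τ → Unit (- (σ * τ))
  unit-neg-* (inj₁ p) (inj₁ q) = inj₂ (-‿cong (trans (*-cong p q) (*-identityˡ _)))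
  unit-neg-* (inj₁ p) (inj₂ q) = inj₁ (trans (-‿cong (trans (*-cong p q) (*-identityˡ _))) (-‿involutive _))
  unit-neg-* (inj₂ p) (inj₁ q) = inj₁ (trans (-‿cong (trans (*-cong p q) (*-identityʳ _))) (-‿involutive _))
  unit-neg-* (inj₂ p) (inj₂ q) = inj₂ (trans (-‿cong (*-cong p q)) (solve 0 (:- ((:- con (+ 1)) :* (:- con (+ 1))) := :- con (+ 1)) refl))

  unit-1+ : ∀ {σ} → Unit σ → NonNeg (1# + σ)
  unit-1+ (inj₁ p) = nonNeg-resp (+-congˡ (sym p)) (nonNeg-+ nonNeg-1 nonNeg-1)
  unit-1+ (inj₂ p) = nonNeg-resp (sym (trans (+-congˡ p) (-‿inverseʳ 1#))) nonNeg-0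

  -- Stable under the elimination of a vertex (row-drop, row-fold); the eliminations create the minus signs.
  data Row {n} (i : Fin n) : (Fin n → Carrier) → Set (c ⊔ ℓ ⊔ p) where
    none : ∀ {r} → (∀ j → r j ≈ 0#) → Row i r
    loop : ∀ {r r′} a → NonNeg a → Row i r → (∀ j → r′ j ≈ r j + a * δ i j) → Row i r′
    arc  : ∀ {r r′} a σ k → NonNeg a → Unit σ → Row i r → (∀ j → r′ j ≈ r j + a * (δ i j + σ * δ k j)) → Row i r′

  row-resp : ∀ {n} {i : Fin n} {r r′} → (∀ j → r′ j ≈ r j) → Row i r → Row i r′
  row-resp eq (none z)               = none (λ j → trans (eq j) (z j))
  row-resp eq (loop a a≥0 ρ e)       = loop a a≥0 ρ (λ j → trans (eq j) (e j))
  row-resp eq (arc a σ k a≥0 u ρ e)  = arc a σ k a≥0 u ρ (λ j → trans (eq j) (e j))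

  row-+ : ∀ {n} {i : Fin n} {r s} → Row i r → Row i s → Row i (λ j → r j + s j)
  row-+ ρ (none z)              = row-resp (λ j → trans (+-congˡ (z j)) (+-identityʳ _)) ρ
  row-+ ρ (loop a a≥0 ρ′ e)     = loop a a≥0 (row-+ ρ ρ′) (λ j → trans (+-congˡ (e j)) (sym (+-assoc _ _ _)))
  row-+ ρ (arc a σ k a≥0 u ρ′ e) = arc a σ k a≥0 u (row-+ ρ ρ′) (λ j → trans (+-congˡ (e j)) (sym (+-assoc _ _ _)))

  drop : ∀ {n} → (Fin (suc n) → Carrier) → Fin n → Carrier
  drop r j = r (suc j)

  fold : ∀ {n} → Fin n → Carrier → (Fin (suc n) → Carrier) → Fin n → Carrier
  fold k σ r j = r (suc j) + - σ * (δ k j * r zero)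

  -- An arc into the deleted vertex keeps only its diagonal part and becomes a loop.
  row-drop : ∀ {n} {i : Fin n} {r} → Row (suc i) r → Row i (drop r)
  row-drop (none z)                     = none (λ j → z (suc j))
  row-drop (loop a a≥0 ρ e)             = loop a a≥0 (row-drop ρ) (λ j → e (suc j))
  row-drop (arc a σ zero a≥0 u ρ e)     = loop a a≥0 (row-drop ρ) (λ j → trans (e (suc j)) (+-congˡ (*-congˡ (trans (+-congˡ (zeroʳ _)) (+-identityʳ _)))))
  row-drop (arc a σ (suc k) a≥0 u ρ e)  = arc a σ k a≥0 u (row-drop ρ) (λ j → e (suc j))

  -- Elimination along an arc of sign σ from `zero` to `k` redirects an arc of sign τ into `zero` to
  -- `k`, with sign -στ; loops and other arcs survive unchanged.
  row-fold : ∀ {n} {i : Fin n} {r} k σ → Unit σ → Row (suc i) r → Row i (fold k σ r)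
  row-fold k σ v (none z) = none λ j → trans (+-cong (z (suc j)) (*-congˡ (*-congˡ (z zero))))
    (solve 2 (λ s d → con (+ 0) :+ (:- s) :* (d :* con (+ 0)) := con (+ 0)) refl σ (δ k j))
  row-fold {i = i} {r} k σ v (loop {s} a a≥0 ρ e) = loop a a≥0 (row-fold k σ v ρ) λ j →
    trans (+-cong (e (suc j)) (*-congˡ (*-congˡ (e zero))))
      (solve 6 (λ s d x y a i → (x :+ a :* i) :+ (:- s) :* (d :* (y :+ a :* con (+ 0))) := (x :+ (:- s) :* (d :* y)) :+ a :* i)
        refl σ (δ k j) (s (suc j)) (s zero) a (δ i j))
  row-fold {i = i} k σ v (arc {s} a τ zero a≥0 u ρ e) = arc a (- (σ * τ)) k a≥0 (unit-neg-* v u) (row-fold k σ v ρ) λ j →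
    trans (+-cong (e (suc j)) (*-congˡ (*-congˡ (e zero))))
      (solve 7 (λ s d x y a i t → (x :+ a :* (i :+ t :* con (+ 0))) :+ (:- s) :* (d :* (y :+ a :* (con (+ 0) :+ t :* con (+ 1))))
                  := (x :+ (:- s) :* (d :* y)) :+ a :* (i :+ (:- (s :* t)) :* d))
        refl σ (δ k j) (s (suc j)) (s zero) a (δ i j) τ)
  row-fold {i = i} k σ v (arc {s} a τ (suc m) a≥0 u ρ e) = arc a τ m a≥0 u (row-fold k σ v ρ) λ j →
    trans (+-cong (e (suc j)) (*-congˡ (*-congˡ (e zero))))
      (solve 8 (λ s d x y a i t m → (x :+ a :* (i :+ t :* m)) :+ (:- s) :* (d :* (y :+ a :* (con (+ 0) :+ t :* con (+ 0))))
                  := (x :+ (:- s) :* (d :* y)) :+ a :* (i :+ t :* m))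
        refl σ (δ k j) (s (suc j)) (s zero) a (δ i j) τ (δ m j))

  det-zero-row : ∀ n r (X : Fin n → Fin (suc n) → Carrier) → (∀ j → r j ≈ 0#) → det (suc n) (row r X) ≈ 0#
  det-zero-row n r X z = trans (det-expand n _) (∑-vanish λ j → trans (*-congˡ (trans (*-congʳ (z j)) (zeroˡ _))) (zeroʳ _))

  det-add-row : ∀ n a {r s t} (X : Fin n → Fin (suc n) → Carrier) → (∀ j → r j ≈ s j + a * t j) →
    det (suc n) (row r X) ≈ det (suc n) (row s X) + a * det (suc n) (row t X)
  det-add-row n a X eq = det-row-linear zero a eq (λ i j → refl) (λ i j → refl)

  module _ n (X Y : Fin n → Fin (suc n) → Carrier) (q : Carrier)
    (dropped : NonNeg (det n (λ i → drop (X i)) - q * det n (λ i → drop (Y i))))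
    (folded : ∀ k σ → Unit σ → NonNeg (det n (λ i → fold k σ (X i)) - q * det n (λ i → fold k σ (Y i)))) where

    private
      add : ∀ a {r s t} → (∀ j → r j ≈ s j + a * t j) → NonNeg a →
        NonNeg (det (suc n) (row s X) - q * det (suc n) (row s Y)) →
        NonNeg (det (suc n) (row t X) - q * det (suc n) (row t Y)) →
        NonNeg (det (suc n) (row r X) - q * det (suc n) (row r Y))
      add a eq a≥0 p p′ = nonNeg-resp
        (trans (solve 6 (λ x y a b q e → (x :- q :* y) :+ a :* (b :- q :* e) := (x :+ a :* b) :- q :* (y :+ a :* e)) refl _ _ a _ q _)
               (sym (+-cong (det-add-row n a X eq) (-‿cong (*-congˡ (det-add-row n a Y eq))))))
        (nonNeg-+ p (nonNeg-* a≥0 p′))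

      atδ : NonNeg (det (suc n) (row (δ zero) X) - q * det (suc n) (row (δ zero) Y))
      atδ = nonNeg-resp (sym (+-cong (trans (det-row-δ n zero X) (*-identityˡ _)) (-‿cong (*-congˡ (trans (det-row-δ n zero Y) (*-identityˡ _)))))) dropped

    -- One induction serves two purposes: `q` is `0#` for nonnegativity and `1#` for comparison. An
    -- arc from `zero` to itself counts as a loop of weight a (1 + σ), which is 0 or 2a.
    expand-row : ∀ {r} → Row zero r → NonNeg (det (suc n) (row r X) - q * det (suc n) (row r Y))
    expand-row {r} (none z) = nonNeg-resp
      (sym (trans (+-cong (det-zero-row n r X z) (-‿cong (*-congˡ (det-zero-row n r Y z)))) (solve 1 (λ q → con (+ 0) :- q :* con (+ 0) := con (+ 0)) refl q)))
      nonNeg-0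
    expand-row (loop a a≥0 ρ e) = add a e a≥0 (expand-row ρ) atδ
    expand-row (arc a σ zero a≥0 u ρ e) = add (a * (1# + σ))
      (λ j → trans (e j) (+-congˡ (solve 3 (λ a s d → a :* (d :+ s :* d) := a :* (con (+ 1) :+ s) :* d) refl a σ (δ zero j))))
      (nonNeg-* a≥0 (unit-1+ u)) (expand-row ρ) atδ
    expand-row (arc a σ (suc k) a≥0 u ρ e) = add a e a≥0 (expand-row ρ)
      (nonNeg-resp (sym (+-cong (det-eliminate n k σ X) (-‿cong (*-congˡ (det-eliminate n k σ Y))))) (folded k σ u))

  det-split : ∀ n (M : Mat (suc n)) → det (suc n) M ≈ det (suc n) (row (M zero) (λ i → M (suc i)))
  det-split n M = det-cong (suc n) λ { zero j → refl ; (suc i) j → refl }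

  nonNeg-minus-0* : ∀ {a b} → NonNeg a → NonNeg (a - 0# * b)
  nonNeg-minus-0* {a} {b} = nonNeg-resp (solve 2 (λ a b → a := a :- con (+ 0) :* b) refl a b)

  det-nonNeg : ∀ n (X : Mat n) → (∀ i → Row i (X i)) → NonNeg (det n X)
  det-nonNeg zero    X ρ = nonNeg-resp (sym (det-empty X)) nonNeg-1
  det-nonNeg (suc n) X ρ = nonNeg-resp
    (trans (solve 2 (λ a b → a :- con (+ 0) :* b := a) refl _ _) (sym (det-split n X)))
    (expand-row n (λ i → X (suc i)) (λ i → X (suc i)) 0#
      (nonNeg-minus-0* (det-nonNeg n _ (λ i → row-drop (ρ (suc i)))))
      (λ k σ u → nonNeg-minus-0* (det-nonNeg n _ (λ i → row-fold k σ u (ρ (suc i)))))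
      (ρ zero))

  -- The increase splits into the change of the lower rows under the first row of `B`, where the
  -- minors compare by induction, and a nonnegative determinant whose first row comes from `E`.
  det-mono : ∀ n (B E : Mat n) → (∀ i → Row i (B i)) → (∀ i → Row i (E i)) → det n B ⊑ det n (λ i j → B i j + E i j)
  det-mono zero B E β ε = nonNeg-resp (sym (trans (+-cong (det-empty _) (-‿cong (det-empty _))) (-‿inverseʳ 1#))) nonNeg-0
  det-mono (suc n) B E β ε = nonNeg-resp eq
    (nonNeg-+ (expand-row n S (λ i → B (suc i)) 1#
                 (times-1 (det-mono n _ _ (λ i → row-drop (β (suc i))) (λ i → row-drop (ε (suc i)))))
                 (λ k σ u → times-1 (nonNeg-resp (+-congʳ (det-cong n (λ i j →
                     solve 6 (λ x y s d a b → (x :+ (:- s) :* (d :* a)) :+ (y :+ (:- s) :* (d :* b)) := (x :+ y) :+ (:- s) :* (d :* (a :+ b))) refl _ _ σ (δ k j) _ _)))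
                   (det-mono n _ _ (λ i → row-fold k σ u (β (suc i))) (λ i → row-fold k σ u (ε (suc i))))))
                 (β zero))
              (det-nonNeg (suc n) (row (E zero) S) (λ { zero → ε zero ; (suc i) → row-+ (β (suc i)) (ε (suc i)) })))
    where
    S : Fin n → Fin (suc n) → Carrier
    S i j = B (suc i) j + E (suc i) j
    times-1 : ∀ {a b} → NonNeg (a - b) → NonNeg (a - 1# * b)
    times-1 = nonNeg-resp (+-congˡ (-‿cong (sym (*-identityˡ _))))
    eq : (det (suc n) (row (B zero) S) - 1# * det (suc n) (row (B zero) (λ i → B (suc i)))) + det (suc n) (row (E zero) S)
       ≈ det (suc n) (λ i j → B i j + E i j) - det (suc n) B
    eq = trans (solve 3 (λ a b e → (a :- con (+ 1) :* b) :+ e := (a :+ con (+ 1) :* e) :- b) refl _ _ _)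
      (+-cong (trans (sym (det-add-row n 1# S (λ j → +-congˡ (sym (*-identityˡ _))))) (sym (det-split n (λ i j → B i j + E i j))))
              (-‿cong (sym (det-split n B))))

  -- The heads `e` of the arcs vary freely, so the induction on the number of arcs keeps the vertex
  -- set fixed.
  row-arcs : ∀ {m n} (i : Fin n) (e : Fin m → Fin n) (h : Fin m → Carrier) → (∀ k → NonNeg (h k)) →
    Row i (λ j → ∑ (λ k → h k * (δ i j + 1# * δ (e k) j)))
  row-arcs {zero}  i e h h≥0 = none (λ j → ∑-zero _)
  row-arcs {suc m} i e h h≥0 = arc (h zero) 1# (e zero) (h≥0 zero) (inj₁ refl)
    (row-arcs i (λ k → e (suc k)) (λ k → h (suc k)) (λ k → h≥0 (suc k)))
    (λ j → trans (∑-suc _) (+-comm _ _))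

  row-lap : ∀ {n} (w : Fin n → Carrier) (g : Mat n) i → NonNeg (w i) → (∀ j → NonNeg (g i j)) → Row i (lap w g i)
  row-lap w g i w≥0 g≥0 = loop (w i) w≥0 (row-arcs i (λ k → k) (g i) g≥0) λ j → begin
    δ i j * (w i + ∑ (g i)) + g i j
      ≈⟨ solve 4 (λ d w s a → d :* (w :+ s) :+ a := (a :+ d :* s) :+ w :* d) refl _ _ _ _ ⟩
    (g i j + δ i j * ∑ (g i)) + w i * δ i j
      ≈⟨ +-congʳ (+-congʳ (∑-δ j (g i))) ⟨
    (∑ (λ k → δ j k * g i k) + δ i j * ∑ (g i)) + w i * δ i j
      ≈⟨ +-congʳ (∑-linear (δ i j) (λ k → trans (solve 3 (λ h d e → h :* (d :+ con (+ 1) :* e) := e :* h :+ d :* h) refl (g i k) (δ i j) (δ k j))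
           (+-congʳ (*-congʳ (δ-sym k j))))) ⟨
    ∑ (λ k → g i k * (δ i j + 1# * δ k j)) + w i * δ i j ∎

  -- `lap` is additive, so passing to `g′` adds the `lap` of the difference with weight zero.
  det-lap-mono : ∀ n w (g g′ : Mat n) → (∀ i → NonNeg (w i)) → (∀ i j → NonNeg (g i j)) → (∀ i j → g i j ⊑ g′ i j) →
    det n (lap w g) ⊑ det n (lap w g′)
  det-lap-mono n w g g′ w≥0 g≥0 g⊑g′ = ⊑-resp refl (det-cong n eq)
    (det-mono n (lap w g) (lap (λ _ → 0#) d) (λ i → row-lap w g i (w≥0 i) (g≥0 i)) (λ i → row-lap (λ _ → 0#) d i nonNeg-0 (g⊑g′ i)))
    where
    d : Mat n
    d i j = g′ i j - g i j
    sum-eq : ∀ i → ∑ (g i) + ∑ (d i) ≈ ∑ (g′ i)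
    sum-eq i = trans (sym (∑-+ (g i) (d i))) (∑-cong (λ j → solve 2 (λ a b → a :+ (b :- a) := b) refl (g i j) (g′ i j)))
    eq : ∀ i j → lap w g i j + lap (λ _ → 0#) d i j ≈ lap w g′ i j
    eq i j = trans
      (solve 6 (λ e w s t a b → (e :* (w :+ s) :+ a) :+ (e :* (con (+ 0) :+ t) :+ (b :- a)) := e :* (w :+ (s :+ t)) :+ b) refl (δ i j) (w i) (∑ (g i)) (∑ (d i)) (g i j) (g′ i j))
      (+-congʳ (*-congˡ (+-congˡ (sum-eq i))))

-- The affine lower bound for pendent attachments, paths and cycles.

module Bounds {c ℓ ℓ′} (R : CommutativeRing c ℓ) (P : PositiveCone R ℓ′) (x : CommutativeRing.Carrier R) (x≥0 : PositiveCone.NonNeg P x) where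
  open CommutativeRing R hiding (zero)
  open PositiveCone P
  open import Algebra.Properties.Ring ring using (-‿involutive)
  open import Relation.Binary.Reasoning.Setoid setoid
  open IntegerSolver R
  open Determinant R
  open Laplacian R
  open Positivity R P

  num : ℕ → Carrier
  num n = fromℤ (+ n)

  num-nonNeg : ∀ n → NonNeg (num n)
  num-nonNeg zero    = nonNeg-0
  num-nonNeg (suc n) = nonNeg-resp (sym (fromℤ-+ (+ 1) (+ n))) (nonNeg-+ nonNeg-1 (num-nonNeg n))

  -- Certificates: a polynomial written without subtraction is nonnegative at nonnegative arguments.
  -- An inequality is proved by displaying the difference in this form and letting the solver check
  -- the identity.
  data Pos (n : ℕ) : Set where
    ν   : Fin n → Pos n
    ⌜_⌝ : ℕ → Pos n
    _⊹_ : Pos n → Pos n → Pos n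
    _∙_ : Pos n → Pos n → Pos n

  infixl 6 _⊹_
  infixl 7 _∙_

  poly : ∀ {n} → Pos n → Polynomial n
  poly (ν i)   = var i
  poly ⌜ k ⌝   = con (+ k)
  poly (e ⊹ f) = poly e :+ poly f
  poly (e ∙ f) = poly e :* poly f

  poly-nonNeg : ∀ {n} (e : Pos n) (ρ : Vec Carrier n) → (∀ i → NonNeg (lookup ρ i)) → NonNeg (⟦ poly e ⟧ ρ)
  poly-nonNeg (ν i)   ρ ρ≥0 = ρ≥0 i
  poly-nonNeg ⌜ k ⌝   ρ ρ≥0 = num-nonNeg k
  poly-nonNeg (e ⊹ f) ρ ρ≥0 = nonNeg-+ (poly-nonNeg e ρ ρ≥0) (poly-nonNeg f ρ ρ≥0)
  poly-nonNeg (e ∙ f) ρ ρ≥0 = nonNeg-* (poly-nonNeg e ρ ρ≥0) (poly-nonNeg f ρ ρ≥0)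

  ⊑-solve : ∀ {n} (ρ : Vec Carrier n) → (∀ i → NonNeg (lookup ρ i)) → (e f : Polynomial n) (d : Pos n) →
    ⟦ f ⟧↓ ρ ≈ ⟦ e :+ poly d ⟧↓ ρ → ⟦ e ⟧ ρ ⊑ ⟦ f ⟧ ρ
  ⊑-solve ρ ρ≥0 e f d eq = ⊑-by (⟦ poly d ⟧ ρ) (poly-nonNeg d ρ ρ≥0) (prove ρ f (e :+ poly d) eq)

  -- `α zero` is x (x + 2)² (x + 4), the determinant of the 4-cycle with weights x. `β zero` is x (x
  -- + 2)(x² + 4x + 2), x times a principal minor of it, hence the slope in a. The clauses for `suc`
  -- are the constant and linear parts of the recursion of `L`.
  α β : ℕ → Carrier
  α zero    = x * (x * (x * (x + num 8) + num 20) + num 16)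
  α (suc h) = x * α h + (α h + β h)
  β zero    = x * (x * (x * (x + num 6) + num 10) + num 4)
  β (suc h) = x * β h + β h

  -- L h a is the determinant of the 4-cycle with h pendent edges at one vertex,
  -- all vertices having weight x except that one, which has weight x (1 + a).
  L : ℕ → Carrier → Carrier
  L h a = α h + β h * a

  L-cong : ∀ h {a b} → a ≈ b → L h a ≈ L h b
  L-cong h a≈b = +-congˡ (*-congˡ a≈b)

  L-suc : ∀ h a → L (suc h) a ≈ x * L h a + L h (a + 1#)
  L-suc h a = solve 4 (λ x α β a → (x :* α :+ (α :+ β)) :+ (x :* β :+ β) :* a := x :* (α :+ β :* a) :+ (α :+ β :* (a :+ con (+ 1)))) refl x (α h) (β h) a

  β≥0 : ∀ h → NonNeg (β h)
  β≥0 zero = poly-nonNeg (X ∙ (X ∙ (X ∙ (X ⊹ ⌜ 6 ⌝) ⊹ ⌜ 10 ⌝) ⊹ ⌜ 4 ⌝)) (x ∷ []) λ { zero → x≥0 }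
    where
    X : Pos 1
    X = ν 0F
  β≥0 (suc h) = nonNeg-+ (nonNeg-* x≥0 (β≥0 h)) (β≥0 h)

  β⊑α : ∀ h → β h ⊑ α h
  β⊑α zero = ⊑-solve (x ∷ []) (λ { zero → x≥0 }) (poly (X ∙ (X ∙ (X ∙ (X ⊹ ⌜ 6 ⌝) ⊹ ⌜ 10 ⌝) ⊹ ⌜ 4 ⌝)))
    (poly (X ∙ (X ∙ (X ∙ (X ⊹ ⌜ 8 ⌝) ⊹ ⌜ 20 ⌝) ⊹ ⌜ 16 ⌝))) (X ∙ (X ∙ (X ∙ ⌜ 2 ⌝ ⊹ ⌜ 10 ⌝) ⊹ ⌜ 12 ⌝)) refl
    where
    X : Pos 1
    X = ν 0F
  β⊑α (suc h) = nonNeg-resp (solve 3 (λ x a b → x :* (a :- b) :+ a := (x :* a :+ (a :+ b)) :- (x :* b :+ b)) refl x (α h) (β h))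
    (nonNeg-+ (nonNeg-* x≥0 (β⊑α h)) (nonNeg-resp (solve 2 (λ a b → (a :- b) :+ b := a) refl (α h) (β h)) (nonNeg-+ (β⊑α h) (β≥0 h))))

  -- Deleting a pendent vertex removes its share `t` from the sum. The factor `1# + t` from its
  -- weight pays for the loss, because the slope `β h` is at most `α h`.
  L-split : ∀ h {s t} → NonNeg s → NonNeg t → L h (s + t) ⊑ (1# + t) * L h s
  L-split h {s} {t} s≥0 t≥0 = nonNeg-resp
    (solve 4 (λ a b s t → t :* (a :- b) :+ t :* (b :* s) := (con (+ 1) :+ t) :* (a :+ b :* s) :- (a :+ b :* (s :+ t))) refl (α h) (β h) s t)
    (nonNeg-+ (nonNeg-* t≥0 (β⊑α h)) (nonNeg-* t≥0 (nonNeg-* (β≥0 h) s≥0)))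

  weight : ∀ {n} → (Fin n → Carrier) → Fin n → Carrier
  weight a i = x * (1# + a i)

  -- The factor `y` is `1#` for graphs grown from the cycle and `x` for the paths left by deleting a
  -- cycle edge.
  Bounded : Carrier → ℕ → ∀ n → Mat n → Set (c ⊔ ℓ′)
  Bounded y h n g = ∀ a → (∀ i → NonNeg (a i)) → y * L h (∑ a) ⊑ det n (lap (weight a) g)

  ∑-nonNeg : ∀ {n} {f : Fin n → Carrier} → (∀ i → NonNeg (f i)) → NonNeg (∑ f)
  ∑-nonNeg {zero}  f≥0 = nonNeg-resp (sym (∑-zero _)) nonNeg-0
  ∑-nonNeg {suc n} f≥0 = nonNeg-resp (sym (∑-suc _)) (nonNeg-+ (f≥0 zero) (∑-nonNeg (λ i → f≥0 (suc i))))

  δ-nonNeg : ∀ {n} (i j : Fin n) → NonNeg (δ i j)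
  δ-nonNeg zero    zero    = nonNeg-1
  δ-nonNeg zero    (suc j) = nonNeg-0
  δ-nonNeg (suc i) zero    = nonNeg-0
  δ-nonNeg (suc i) (suc j) = δ-nonNeg i j

  -- The new `a` when vertex `zero`, of weight x (1 + `a zero`), is contracted into `u`; the 1 in
  -- that weight is the source of the `+ 1#` in `L-suc`.
  merge : ∀ {n} → Fin n → (Fin (suc n) → Carrier) → Fin n → Carrier
  merge u a i = a (suc i) + (1# + a zero) * δ u i

  merge-nonNeg : ∀ {n} (u : Fin n) {a} → (∀ i → NonNeg (a i)) → ∀ i → NonNeg (merge u a i)
  merge-nonNeg u a≥0 i = nonNeg-+ (a≥0 (suc i)) (nonNeg-* (nonNeg-+ nonNeg-1 (a≥0 zero)) (δ-nonNeg u i))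

  ∑-merge : ∀ {n} (u : Fin n) a → ∑ (merge u a) ≈ ∑ a + 1#
  ∑-merge u a = begin
    ∑ (merge u a)                                          ≈⟨ ∑-linear (1# + a zero) (λ i → refl) ⟩
    ∑ (λ i → a (suc i)) + (1# + a zero) * ∑ (δ u)          ≈⟨ +-congˡ (*-congˡ (∑-δ-1 u)) ⟩
    ∑ (λ i → a (suc i)) + (1# + a zero) * 1#               ≈⟨ solve 2 (λ s t → s :+ (con (+ 1) :+ t) :* con (+ 1) := (t :+ s) :+ con (+ 1)) refl _ _ ⟩
    (a zero + ∑ (λ i → a (suc i))) + 1#                    ≈⟨ +-congʳ (∑-suc a) ⟨
    ∑ a + 1#                                               ∎

  weight-merge : ∀ {n} (u : Fin n) a i → weight a (suc i) + weight a zero * δ u i ≈ weight (merge u a) i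
  weight-merge u a i = solve 4 (λ x s t d → x :* (con (+ 1) :+ s) :+ x :* (con (+ 1) :+ t) :* d := x :* (con (+ 1) :+ (s :+ (con (+ 1) :+ t) :* d))) refl x (a (suc i)) (a zero) (δ u i)

  det-weighted-attach : ∀ n u (g : Mat n) a → det (suc n) (lap (weight a) (attachGraph u g)) ≈
    weight a zero * det n (lap (weight (λ i → a (suc i))) g) + det n (lap (weight (merge u a)) g)
  det-weighted-attach n u g a = trans (det-lap-attach n (weight a) u g) (+-congˡ (det-cong n (lap-cong (weight-merge u a) (λ i j → refl))))

  -- The hypothesis bounds the contraction term directly and the deletion term after `L-split`; the
  -- two bounds add up to the recursion of `L`.
  attach-bounded : ∀ y → NonNeg y → ∀ h n u g → Bounded y h n g → Bounded y (suc h) (suc n) (attachGraph u g)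
  attach-bounded y y≥0 h n u g bound a a≥0 = ⊑-resp lhs (sym (det-weighted-attach n u g a)) (⊑-+
    (⊑-trans (⊑-*ˡ (nonNeg-* x≥0 y≥0) (L-split h (∑-nonNeg (λ i → a≥0 (suc i))) (a≥0 zero)))
      (⊑-resp (solve 4 (λ x y t l → x :* (con (+ 1) :+ t) :* (y :* l) := x :* y :* ((con (+ 1) :+ t) :* l)) refl x y (a zero) _) refl
        (⊑-*ˡ (nonNeg-* x≥0 (nonNeg-+ nonNeg-1 (a≥0 zero))) (bound (λ i → a (suc i)) (λ i → a≥0 (suc i))))))
    (bound (merge u a) (merge-nonNeg u a≥0)))
    where
    lhs : x * y * L h (∑ (λ i → a (suc i)) + a zero) + y * L h (∑ (merge u a)) ≈ y * L (suc h) (∑ a)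
    lhs = begin
      x * y * L h (∑ (λ i → a (suc i)) + a zero) + y * L h (∑ (merge u a))
        ≈⟨ +-cong (*-congˡ (L-cong h (trans (+-comm _ _) (sym (∑-suc a))))) (*-congˡ (L-cong h (∑-merge u a))) ⟩
      x * y * L h (∑ a) + y * L h (∑ a + 1#)
        ≈⟨ solve 4 (λ x y l m → x :* y :* l :+ y :* m := y :* (x :* l :+ m)) refl x y _ _ ⟩
      y * (x * L h (∑ a) + L h (∑ a + 1#))
        ≈⟨ *-congˡ (L-suc h (∑ a)) ⟨
      y * L (suc h) (∑ a) ∎

  chain : ∀ n → Mat (suc n)
  chain zero    i j = 0#
  chain (suc n)     = attachGraph zero (chain n)

  -- The determinant of a weighted path as a bare ring expression. `pathP` is its syntactic copy and
  -- evaluates to it by computation, which is what the solver needs.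
  path : ∀ n → (Fin (suc n) → Carrier) → Carrier
  path zero    w = w zero
  path (suc n) w = w zero * path n (λ i → w (suc i)) + path n (λ i → w (suc i) + w zero * δ zero i)

  det-1 : ∀ (M : Mat 1) → det 1 M ≈ M zero zero
  det-1 M = trans (det-expand 0 M) (trans (∑-suc _) (trans (+-cong (*-congˡ (*-congˡ (det-empty _))) (∑-zero _))
    (solve 1 (λ a → con (+ 1) :* (a :* con (+ 1)) :+ con (+ 0) := a) refl (M zero zero))))

  det-2 : ∀ (M : Mat 2) → det 2 M ≈ M 0F 0F * M 1F 1F - M 0F 1F * M 1F 0F
  det-2 M = trans (det-expand 1 M) (trans (∑-suc _) (trans
    (+-cong (*-congˡ (*-congˡ (det-1 _))) (trans (∑-suc _) (+-cong (*-congˡ (*-congˡ (det-1 _))) (∑-zero _))))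
    (solve 4 (λ a b c d → con (+ 1) :* (a :* d) :+ ((:- con (+ 1)) :* (b :* c) :+ con (+ 0)) := a :* d :- b :* c) refl (M 0F 0F) (M 0F 1F) (M 1F 0F) (M 1F 1F))))

  lap-chain-0 : ∀ w → lap w (chain 0) zero zero ≈ w zero
  lap-chain-0 w = trans (+-congʳ (*-congˡ (+-congˡ (∑-vanish (λ j → refl))))) (solve 1 (λ w → con (+ 1) :* (w :+ con (+ 0)) :+ con (+ 0) := w) refl (w zero))

  det-chain : ∀ n w → det (suc n) (lap w (chain n)) ≈ path n w
  det-chain zero    w = trans (det-1 _) (lap-chain-0 w)
  det-chain (suc n) w = trans (det-lap-attach (suc n) w zero (chain n)) (+-cong (*-congˡ (det-chain n _)) (det-chain n _))

  δP : ∀ {m n} → Fin n → Fin n → Pos m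
  δP zero    zero    = ⌜ 1 ⌝
  δP zero    (suc j) = ⌜ 0 ⌝
  δP (suc i) zero    = ⌜ 0 ⌝
  δP (suc i) (suc j) = δP i j

  pathP : ∀ {m} n → (Fin (suc n) → Pos m) → Pos m
  pathP zero    w = w zero
  pathP (suc n) w = w zero ∙ pathP n (λ i → w (suc i)) ⊹ pathP n (λ i → w (suc i) ⊹ w zero ∙ δP zero i)

  weightP : ∀ n → Fin n → Pos (suc n)
  weightP n i = ν zero ∙ (⌜ 1 ⌝ ⊹ ν (suc i))

  αP βP : ∀ {n} → Pos (suc n)
  αP = ν zero ∙ (ν zero ∙ (ν zero ∙ (ν zero ⊹ ⌜ 8 ⌝) ⊹ ⌜ 20 ⌝) ⊹ ⌜ 16 ⌝)
  βP = ν zero ∙ (ν zero ∙ (ν zero ∙ (ν zero ⊹ ⌜ 6 ⌝) ⊹ ⌜ 10 ⌝) ⊹ ⌜ 4 ⌝)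

  total excess : ∀ {n} → List (Pos n) → Pos n
  total []        = ⌜ 0 ⌝
  total (e ∷ es)  = e ⊹ total es

  -- ∏ (1 + e) = 1 + total es + excess es
  excess []       = ⌜ 0 ⌝
  excess (e ∷ es) = excess es ⊹ e ∙ (total es ⊹ excess es)

  nonNeg-∷ : ∀ {n} (a : Fin n → Carrier) → (∀ i → NonNeg (a i)) → ∀ i → NonNeg (lookup (x ∷ tabulate a) i)
  nonNeg-∷ a a≥0 zero    = x≥0
  nonNeg-∷ a a≥0 (suc i) = ≡.subst NonNeg (≡.sym (lookup∘tabulate a i)) (a≥0 i)

  -- The coefficient of ∏ᵢ (1 + aᵢ) over i ∈ S in the determinant of a weighted path is x^|S|
  -- times the product of the gaps between consecutive elements of S.
  path₅-excess : Pos 6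
  path₅-excess =
      X ∙ (⌜ 5 ⌝ ⊹ total (a ∷ b ∷ c′ ∷ d ∷ e ∷ [])
    ⊹ X ∙ (⌜ 4 ⌝ ⊹ (⌜ 6 ⌝ ∙ a ⊹ ⌜ 3 ⌝ ∙ b ⊹ ⌜ 2 ⌝ ∙ c′ ⊹ ⌜ 3 ⌝ ∙ d ⊹ ⌜ 6 ⌝ ∙ e)
                 ⊹ (a ∙ b ⊹ b ∙ c′ ⊹ c′ ∙ d ⊹ d ∙ e ⊹ ⌜ 2 ⌝ ∙ (a ∙ c′ ⊹ b ∙ d ⊹ c′ ∙ e) ⊹ ⌜ 3 ⌝ ∙ (a ∙ d ⊹ b ∙ e) ⊹ ⌜ 4 ⌝ ∙ a ∙ e)
    ⊹ X ∙ (⌜ 1 ⌝ ⊹ (⌜ 5 ⌝ ∙ (a ⊹ e) ⊹ b ⊹ c′ ⊹ d)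
                 ⊹ (excess (a ∷ b ∷ c′ ∷ []) ⊹ excess (b ∷ c′ ∷ d ∷ []) ⊹ excess (c′ ∷ d ∷ e ∷ [])
                    ⊹ ⌜ 2 ⌝ ∙ (excess (a ∷ b ∷ d ∷ []) ⊹ excess (a ∷ c′ ∷ d ∷ []) ⊹ excess (b ∷ c′ ∷ e ∷ []) ⊹ excess (b ∷ d ∷ e ∷ []))
                    ⊹ ⌜ 3 ⌝ ∙ (excess (a ∷ b ∷ e ∷ []) ⊹ excess (a ∷ d ∷ e ∷ [])) ⊹ ⌜ 4 ⌝ ∙ excess (a ∷ c′ ∷ e ∷ []))
    ⊹ X ∙ (a ⊹ e ⊹ (excess (a ∷ b ∷ c′ ∷ d ∷ []) ⊹ excess (b ∷ c′ ∷ d ∷ e ∷ [])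
                    ⊹ ⌜ 2 ⌝ ∙ (excess (a ∷ b ∷ c′ ∷ e ∷ []) ⊹ excess (a ∷ b ∷ d ∷ e ∷ []) ⊹ excess (a ∷ c′ ∷ d ∷ e ∷ [])))
    ⊹ X ∙ excess (a ∷ b ∷ c′ ∷ d ∷ e ∷ [])))))
    where
    X a b c′ d e : Pos 6
    X = ν 0F
    a = ν 1F
    b = ν 2F
    c′ = ν 3F
    d = ν 4F
    e = ν 5F

  ∑-5 : ∀ (a : Fin 5 → Carrier) → ∑ a ≈ a 0F + (a 1F + (a 2F + (a 3F + (a 4F + 0#))))
  ∑-5 a = trans (∑-suc _) (+-congˡ (trans (∑-suc _) (+-congˡ (trans (∑-suc _) (+-congˡ (trans (∑-suc _) (+-congˡ (trans (∑-suc _) (+-congˡ (∑-zero _))))))))))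

  -- Five vertices, because the shortest cycle reduced to the 4-cycle is the 5-cycle, and deleting
  -- its closing edge leaves this path.
  path₅-bounded : Bounded x 0 5 (chain 4)
  path₅-bounded a a≥0 = ⊑-resp (*-congˡ (L-cong 0 (sym (∑-5 a)))) (sym (det-chain 4 (weight a)))
    (⊑-solve (x ∷ tabulate a) (nonNeg-∷ a a≥0)
      (poly (ν 0F ∙ (αP ⊹ βP ∙ total (ν 1F ∷ ν 2F ∷ ν 3F ∷ ν 4F ∷ ν 5F ∷ []))))
      (poly (pathP 4 (weightP 5))) path₅-excess refl)

  chain-bounded : ∀ h → Bounded x h (5 ℕ.+ h) (chain (4 ℕ.+ h))
  chain-bounded zero    = path₅-bounded
  chain-bounded (suc h) = attach-bounded x x≥0 h (5 ℕ.+ h) zero (chain (4 ℕ.+ h)) (chain-bounded h)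

  close-cong : ∀ {n σ τ} k {M N : Mat (suc n)} → σ ≈ τ → (∀ i j → M i j ≈ N i j) → ∀ i j → close σ k M i j ≈ close τ k N i j
  close-cong k σ≈τ M≈N i j = +-cong (M≈N i j) (*-cong (+-congˡ (*-congʳ σ≈τ)) (+-congˡ (*-congʳ σ≈τ)))

  -- Deleting the closing edge leaves the path. Contracting it merges `zero` into the far end, which
  -- gives a cycle one shorter, closed with the opposite sign.
  det-close-chain : ∀ n σ → σ * σ ≈ 1# → ∀ w → det (3 ℕ.+ n) (close σ (fromℕ (2 ℕ.+ n)) (lap w (chain (2 ℕ.+ n)))) ≈
    det (3 ℕ.+ n) (lap w (chain (2 ℕ.+ n))) +
    det (2 ℕ.+ n) (close (- σ) (fromℕ (1 ℕ.+ n)) (lap (λ i → w (suc i) + w zero * δ (fromℕ (1 ℕ.+ n)) i) (chain (1 ℕ.+ n))))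
  det-close-chain n σ σ² w = begin
    det (3 ℕ.+ n) (close σ (fromℕ (2 ℕ.+ n)) (lap w (chain (2 ℕ.+ n))))
      ≈⟨ det-cong (3 ℕ.+ n) (close-cong (fromℕ (2 ℕ.+ n)) refl (lap-attach w zero (chain (1 ℕ.+ n)))) ⟩
    det (3 ℕ.+ n) (close σ (fromℕ (2 ℕ.+ n)) (attach (w zero) zero N))
      ≈⟨ det-close n (fromℕ n) σ σ² (w zero) N ⟩
    det (3 ℕ.+ n) (attach (w zero) zero N) + det (2 ℕ.+ n) (close (- σ) κ (bump (w zero) κ N))
      ≈⟨ +-cong (det-cong (3 ℕ.+ n) (λ i j → sym (lap-attach w zero (chain (1 ℕ.+ n)) i j)))
                (det-cong (2 ℕ.+ n) (close-cong κ refl (lap-bump (w zero) κ (λ i → w (suc i)) (chain (1 ℕ.+ n))))) ⟩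
    det (3 ℕ.+ n) (lap w (chain (2 ℕ.+ n))) + det (2 ℕ.+ n) (close (- σ) κ (lap (λ i → w (suc i) + w zero * δ κ i) (chain (1 ℕ.+ n)))) ∎
    where
    κ : Fin (2 ℕ.+ n)
    κ = fromℕ (1 ℕ.+ n)
    N : Mat (2 ℕ.+ n)
    N = lap (λ i → w (suc i)) (chain (1 ℕ.+ n))

  -- Two vertices joined by a double edge: (w₀ + 2)(w₁ + 2) - 4.
  digon : (Fin 2 → Carrier) → Carrier
  digon w = w 0F * w 1F + num 2 * (w 0F + w 1F)

  det-digon : ∀ w → det 2 (close 1# 1F (lap w (chain 1))) ≈ digon w
  det-digon w = trans (det-2 _) (trans
    (+-cong (*-cong (+-congʳ (lap-attach w zero (chain 0) 0F 0F)) (+-congʳ (trans (lap-attach w zero (chain 0) 1F 1F) (+-congʳ (lap-chain-0 (λ i → w (suc i)))))))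
            (-‿cong (*-cong (+-congʳ (lap-attach w zero (chain 0) 0F 1F)) (+-congʳ (lap-attach w zero (chain 0) 1F 0F)))))
    (solve 2 (λ a b → ((a :+ con (+ 1)) :+ l :* l) :* ((b :+ con (+ 1) :* con (+ 1)) :+ r :* r) :- (con (+ 1) :+ l :* r) :* (con (+ 1) :+ r :* l) := a :* b :+ con (+ 2) :* (a :+ b)) refl (w 0F) (w 1F)))
    where
    l r : ∀ {n} → Polynomial n
    l = con (+ 1) :+ con (+ 1) :* con (+ 0)
    r = con (+ 0) :+ con (+ 1) :* con (+ 1)

  square : (Fin 4 → Carrier) → Carrier
  square w = path 3 w + (path 2 w′ + digon (λ i → w′ (suc i) + w′ zero * δ 1F i))
    where
    w′ : Fin 3 → Carrier
    w′ i = w (suc i) + w zero * δ 2F i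

  -- Two contractions lead through a triangle closed with sign -1 to the double edge, where the sign
  -- is 1 again.
  det-square : ∀ w → det 4 (close 1# 3F (lap w (chain 3))) ≈ square w
  det-square w = trans (det-close-chain 1 1# (*-identityˡ 1#) w) (+-cong (det-chain 3 w)
    (trans (det-close-chain 0 (- 1#) (trans (solve 1 (λ a → (:- a) :* (:- a) := a :* a) refl 1#) (*-identityˡ 1#)) _)
      (+-cong (det-chain 2 _) (trans (det-cong 2 (close-cong 1F (-‿involutive 1#) (λ i j → refl))) (det-digon _)))))

  squareP : ∀ {m} → (Fin 4 → Pos m) → Pos m
  squareP {m} w = pathP 3 w ⊹ (pathP 2 w′ ⊹ (w″ 0F ∙ w″ 1F ⊹ ⌜ 2 ⌝ ∙ (w″ 0F ⊹ w″ 1F)))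
    where
    w′ : Fin 3 → Pos m
    w′ i = w (suc i) ⊹ w zero ∙ δP 2F i
    w″ : Fin 2 → Pos m
    w″ i = w′ (suc i) ⊹ w′ zero ∙ δP 1F i

  -- The constant and linear terms in a, b, c′, d have cancelled against the bound. The coefficients
  -- 3, 4 and 2 count the spanning forests of the 4-cycle with one tree for each of two adjacent,
  -- two opposite, or three chosen vertices.
  square-excess : Pos 5
  square-excess = X ∙ X ∙ (⌜ 3 ⌝ ∙ (a ∙ b ⊹ b ∙ c′ ⊹ c′ ∙ d ⊹ d ∙ a) ⊹ ⌜ 4 ⌝ ∙ (a ∙ c′ ⊹ b ∙ d)
    ⊹ X ∙ (⌜ 2 ⌝ ∙ (excess (a ∷ b ∷ c′ ∷ []) ⊹ excess (a ∷ b ∷ d ∷ []) ⊹ excess (a ∷ c′ ∷ d ∷ []) ⊹ excess (b ∷ c′ ∷ d ∷ []))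
    ⊹ X ∙ excess (a ∷ b ∷ c′ ∷ d ∷ [])))
    where
    X a b c′ d : Pos 5
    X = ν 0F
    a = ν 1F
    b = ν 2F
    c′ = ν 3F
    d = ν 4F

  ∑-4 : ∀ (a : Fin 4 → Carrier) → ∑ a ≈ a 0F + (a 1F + (a 2F + (a 3F + 0#)))
  ∑-4 a = trans (∑-suc _) (+-congˡ (trans (∑-suc _) (+-congˡ (trans (∑-suc _) (+-congˡ (trans (∑-suc _) (+-congˡ (∑-zero _))))))))

  square-bound : ∀ a → (∀ i → NonNeg (a i)) → L 0 (∑ a) ⊑ square (weight a)
  square-bound a a≥0 = ⊑-resp (L-cong 0 (sym (∑-4 a))) refl
    (⊑-solve (x ∷ tabulate a) (nonNeg-∷ a a≥0)
      (poly (αP ⊹ βP ∙ total (ν 1F ∷ ν 2F ∷ ν 3F ∷ ν 4F ∷ [])))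
      (poly (squareP (weightP 4))) square-excess refl)

  square-exact : ∀ a → square (λ i → x * (1# + a * δ 3F i)) ≈ L 0 a
  square-exact a = prove (x ∷ a ∷ []) (poly (squareP (λ i → ν 0F ∙ (⌜ 1 ⌝ ⊹ ν 1F ∙ δP 3F i)))) (poly (αP ⊹ βP ∙ ν 1F)) refl

  -- The closing sign alternates with `h`, so one induction passes through odd lengths too, where
  -- the matrix belongs to a signed cycle. Deletion is bounded by `chain-bounded`, contraction by
  -- the induction hypothesis, and `L-suc` adds the two bounds.
  cycle-bound : ∀ h a → (∀ i → NonNeg (a i)) →
    L h (∑ a) ⊑ det (4 ℕ.+ h) (close (sg h) (fromℕ (3 ℕ.+ h)) (lap (weight a) (chain (3 ℕ.+ h))))
  cycle-bound zero    a a≥0 = ⊑-resp refl (sym (det-square (weight a))) (square-bound a a≥0)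
  cycle-bound (suc h) a a≥0 = ⊑-resp lhs (sym rhs)
    (⊑-+ (chain-bounded h a a≥0) (cycle-bound h (merge κ a) (merge-nonNeg κ a≥0)))
    where
    κ : Fin (4 ℕ.+ h)
    κ = fromℕ (3 ℕ.+ h)
    lhs : x * L h (∑ a) + L h (∑ (merge κ a)) ≈ L (suc h) (∑ a)
    lhs = trans (+-congˡ (L-cong h (∑-merge κ a))) (sym (L-suc h (∑ a)))
    rhs : det (5 ℕ.+ h) (close (- sg h) (fromℕ (4 ℕ.+ h)) (lap (weight a) (chain (4 ℕ.+ h)))) ≈
      det (5 ℕ.+ h) (lap (weight a) (chain (4 ℕ.+ h))) + det (4 ℕ.+ h) (close (sg h) κ (lap (weight (merge κ a)) (chain (3 ℕ.+ h))))
    rhs = trans (det-close-chain (2 ℕ.+ h) (- sg h) (sg-square (suc h)) (weight a))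
      (+-congˡ (det-cong (4 ℕ.+ h) (close-cong κ (-‿involutive _) (lap-cong (weight-merge κ a) (λ i j → refl)))))

  closing : ∀ n → Mat (suc n)
  closing n i j = δ zero i * δ (fromℕ n) j + δ (fromℕ n) i * δ zero j

  cycleGraph : ∀ n → Mat (suc n)
  cycleGraph n i j = chain n i j + closing n i j

  lap-cycleGraph : ∀ n w i j → close 1# (fromℕ n) (lap w (chain n)) i j ≈ lap w (cycleGraph n) i j
  lap-cycleGraph n w i j = begin
    (δ i j * (w i + s) + g) + (p + 1# * q) * (p′ + 1# * q′)
      ≈⟨ solve 8 (λ d w s g p q p′ q′ → (d :* (w :+ s) :+ g) :+ (p :+ con (+ 1) :* q) :* (p′ :+ con (+ 1) :* q′)
                   := (d :* (w :+ s) :+ (p :* p′ :+ q :* q′)) :+ (g :+ (p :* q′ :+ q :* p′))) refl (δ i j) (w i) s g p q p′ q′ ⟩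
    (δ i j * (w i + s) + (p * p′ + q * q′)) + cycleGraph n i j
      ≈⟨ +-congʳ (+-congˡ (+-cong (δ-diagonal zero i j) (δ-diagonal (fromℕ n) i j))) ⟩
    (δ i j * (w i + s) + (δ i j * p + δ i j * q)) + cycleGraph n i j
      ≈⟨ +-congʳ (solve 5 (λ d w s p q → d :* (w :+ s) :+ (d :* p :+ d :* q) := d :* (w :+ (s :+ (p :+ q)))) refl (δ i j) (w i) s p q) ⟩
    δ i j * (w i + (s + (p + q))) + cycleGraph n i j
      ≈⟨ +-congʳ (*-congˡ (+-congˡ degree-eq)) ⟨
    lap w (cycleGraph n) i j ∎
    where
    s = ∑ (chain n i)
    g = chain n i j
    p = δ zero i
    q = δ (fromℕ n) i
    p′ = δ zero j
    q′ = δ (fromℕ n) j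
    degree-eq : ∑ (cycleGraph n i) ≈ s + (p + q)
    degree-eq = trans (∑-+ (chain n i) (closing n i)) (+-congˡ (trans
      (∑-linear q {closing n i} {λ j → p * δ (fromℕ n) j} {δ zero} (λ j → refl))
      (+-cong (trans (sym (∑-* p (δ (fromℕ n)))) (trans (*-congˡ (∑-δ-1 (fromℕ n))) (*-identityʳ p)))
              (trans (*-congˡ (∑-δ-1 (zero {n}))) (*-identityʳ q)))))

  -- The point where even girth enters: the closing edge has sign `1#`, so the matrix is the
  -- signless Laplacian of a genuine cycle.
  cycle-bounded : ∀ h → sg h ≈ 1# → Bounded 1# h (4 ℕ.+ h) (cycleGraph (3 ℕ.+ h))
  cycle-bounded h even a a≥0 = ⊑-resp (sym (*-identityˡ _))
    (det-cong (4 ℕ.+ h) (λ i j → trans (close-cong (fromℕ (3 ℕ.+ h)) {lap (weight a) (chain (3 ℕ.+ h))} even (λ i j → refl) i j) (lap-cycleGraph (3 ℕ.+ h) (weight a) i j)))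
    (cycle-bound h a a≥0)

  mono-bounded : ∀ y h n g g′ → (∀ i j → NonNeg (g i j)) → (∀ i j → g i j ⊑ g′ i j) → Bounded y h n g → Bounded y h n g′
  mono-bounded y h n g g′ g≥0 g⊑g′ bound a a≥0 = ⊑-trans (bound a a≥0)
    (det-lap-mono n (weight a) g g′ (λ i → nonNeg-* x≥0 (nonNeg-+ nonNeg-1 (a≥0 i))) g≥0 g⊑g′)

-- The extremal graph, and growing a graph from its cycle.

module Growth {c ℓ ℓ′} (R : CommutativeRing c ℓ) (P : PositiveCone R ℓ′) (x : CommutativeRing.Carrier R) (x≥0 : PositiveCone.NonNeg P x) where
  open CommutativeRing R hiding (zero)
  open PositiveCone P
  open import Relation.Binary.Reasoning.Setoid setoid
  open IntegerSolver R
  open Determinant R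
  open Laplacian R
  open Positivity R P
  open Bounds R P x x≥0

  indicator : Bool → Carrier
  indicator true  = 1#
  indicator false = 0#

  indicator-nonNeg : ∀ b → NonNeg (indicator b)
  indicator-nonNeg true  = nonNeg-1
  indicator-nonNeg false = nonNeg-0

  adjacency : ∀ {n} → Graph n → Mat n
  adjacency G i j = indicator (G i j)

  -- The vertex labelled 3, obtained by skipping the last vertex so that it fits the reordering in
  -- `S4'-suc`.
  center : ∀ m → Fin (m ℕ.+ 4)
  center zero    = 3F
  center (suc m) = punchIn (fromℕ (m ℕ.+ 4)) (center m)

  toℕ-punchIn-last : ∀ n (i : Fin n) → toℕ (punchIn (fromℕ n) i) ≡ toℕ i
  toℕ-punchIn-last (suc n) zero    = ≡.refl
  toℕ-punchIn-last (suc n) (suc i) = ≡.cong suc (toℕ-punchIn-last n i)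

  toℕ-center : ∀ m → toℕ (center m) ≡ 3
  toℕ-center zero    = ≡.refl
  toℕ-center (suc m) = ≡.trans (toℕ-punchIn-last (m ℕ.+ 4) (center m)) (toℕ-center m)

  toFront-injective : ∀ {n} (v : Fin (suc n)) → Injective _≡_ _≡_ (toFront v)
  toFront-injective v {zero}  {zero}  eq = ≡.refl
  toFront-injective v {zero}  {suc j} eq = contradiction (≡.sym eq) (punchInᵢ≢i v j)
  toFront-injective v {suc i} {zero}  eq = contradiction eq (punchInᵢ≢i v i)
  toFront-injective v {suc i} {suc j} eq = ≡.cong suc (punchIn-injective v i j eq)

  indicator-≡ᵇ : ∀ {n} (j k : Fin n) → indicator (toℕ j ≡ᵇ toℕ k) ≈ δ k j
  indicator-≡ᵇ zero    zero    = refl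
  indicator-≡ᵇ zero    (suc k) = refl
  indicator-≡ᵇ (suc j) zero    = refl
  indicator-≡ᵇ (suc j) (suc k) = indicator-≡ᵇ j k

  s4edge-to-pendent : ∀ m b → s4edge b (4 ℕ.+ m) ≡ (b ≡ᵇ 3)
  s4edge-to-pendent m 0 = ≡.refl
  s4edge-to-pendent m 1 = ≡.refl
  s4edge-to-pendent m 2 = ≡.refl
  s4edge-to-pendent m 3 = ≡.refl
  s4edge-to-pendent m (suc (suc (suc (suc b)))) = ≡.refl

  -- The newest pendent vertex is labelled last, whereas `attachGraph` puts the new vertex first;
  -- `toFront` translates.
  S4'-suc : ∀ m i j → adjacency (S4' (suc m)) (toFront (fromℕ (m ℕ.+ 4)) i) (toFront (fromℕ (m ℕ.+ 4)) j) ≈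
    attachGraph (center m) (adjacency (S4' m)) i j
  S4'-suc m zero zero rewrite toℕ-fromℕ (m ℕ.+ 4) | ℕₚ.+-comm m 4 = refl
  S4'-suc m zero (suc j) rewrite toℕ-punchIn-last (m ℕ.+ 4) j | toℕ-fromℕ (m ℕ.+ 4) = trans
    (reflexive (≡.cong indicator (≡.trans (≡.cong (λ k → s4edge k (toℕ j) ∨ s4edge (toℕ j) k) (ℕₚ.+-comm m 4))
      (≡.trans (s4edge-to-pendent m (toℕ j)) (≡.cong (toℕ j ≡ᵇ_) (≡.sym (toℕ-center m)))))))
    (indicator-≡ᵇ j (center m))
  S4'-suc m (suc i) zero rewrite toℕ-punchIn-last (m ℕ.+ 4) i | toℕ-fromℕ (m ℕ.+ 4) = trans
    (reflexive (≡.cong indicator (≡.trans (≡.cong (λ k → s4edge (toℕ i) k ∨ s4edge k (toℕ i)) (ℕₚ.+-comm m 4))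
      (≡.trans (≡.trans (∨-identityʳ _) (s4edge-to-pendent m (toℕ i))) (≡.cong (toℕ i ≡ᵇ_) (≡.sym (toℕ-center m)))))))
    (indicator-≡ᵇ i (center m))
  S4'-suc m (suc i) (suc j) rewrite toℕ-punchIn-last (m ℕ.+ 4) i | toℕ-punchIn-last (m ℕ.+ 4) j = refl

  chainP : ∀ n → Fin (suc n) → Fin (suc n) → Pos 0
  chainP zero    i       j       = ⌜ 0 ⌝
  chainP (suc n) zero    zero    = ⌜ 0 ⌝
  chainP (suc n) zero    (suc j) = δP zero j
  chainP (suc n) (suc i) zero    = δP zero i
  chainP (suc n) (suc i) (suc j) = chainP n i j

  cycleP : ∀ n → Fin (suc n) → Fin (suc n) → Pos 0
  cycleP n i j = chainP n i j ⊹ (δP zero i ∙ δP (fromℕ n) j ⊹ δP (fromℕ n) i ∙ δP zero j)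

  S4'-zero : ∀ i j → cycleGraph 3 i j ≈ adjacency (S4' 0) i j
  S4'-zero 0F 0F = prove [] (poly (cycleP 3 0F 0F)) (con (+ 0)) refl
  S4'-zero 0F 1F = prove [] (poly (cycleP 3 0F 1F)) (con (+ 1)) refl
  S4'-zero 0F 2F = prove [] (poly (cycleP 3 0F 2F)) (con (+ 0)) refl
  S4'-zero 0F 3F = prove [] (poly (cycleP 3 0F 3F)) (con (+ 1)) refl
  S4'-zero 1F 0F = prove [] (poly (cycleP 3 1F 0F)) (con (+ 1)) refl
  S4'-zero 1F 1F = prove [] (poly (cycleP 3 1F 1F)) (con (+ 0)) refl
  S4'-zero 1F 2F = prove [] (poly (cycleP 3 1F 2F)) (con (+ 1)) refl
  S4'-zero 1F 3F = prove [] (poly (cycleP 3 1F 3F)) (con (+ 0)) refl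
  S4'-zero 2F 0F = prove [] (poly (cycleP 3 2F 0F)) (con (+ 0)) refl
  S4'-zero 2F 1F = prove [] (poly (cycleP 3 2F 1F)) (con (+ 1)) refl
  S4'-zero 2F 2F = prove [] (poly (cycleP 3 2F 2F)) (con (+ 0)) refl
  S4'-zero 2F 3F = prove [] (poly (cycleP 3 2F 3F)) (con (+ 1)) refl
  S4'-zero 3F 0F = prove [] (poly (cycleP 3 3F 0F)) (con (+ 1)) refl
  S4'-zero 3F 1F = prove [] (poly (cycleP 3 3F 1F)) (con (+ 0)) refl
  S4'-zero 3F 2F = prove [] (poly (cycleP 3 3F 2F)) (con (+ 1)) refl
  S4'-zero 3F 3F = prove [] (poly (cycleP 3 3F 3F)) (con (+ 0)) refl

  centered : ∀ m → Carrier → Fin (m ℕ.+ 4) → Carrier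
  centered m a i = a * δ (center m) i

  -- Each pendent vertex carries a = 0, so deleting it gives exactly x `L m a`, and contracting it
  -- raises the value at the center to `a + 1#`. The induction therefore needs every `a`.
  det-S4' : ∀ m a → det (m ℕ.+ 4) (lap (weight (centered m a)) (adjacency (S4' m))) ≈ L m a
  det-S4' zero a = begin
    det 4 (lap (weight (centered 0 a)) (adjacency (S4' 0)))
      ≈⟨ det-cong 4 (lap-cong (λ i → refl) S4'-zero) ⟨
    det 4 (lap (weight (centered 0 a)) (cycleGraph 3))
      ≈⟨ det-cong 4 (lap-cycleGraph 3 (weight (centered 0 a))) ⟨
    det 4 (close 1# 3F (lap (weight (centered 0 a)) (chain 3)))
      ≈⟨ trans (det-square (weight (centered 0 a))) (square-exact a) ⟩
    L 0 a ∎
  det-S4' (suc m) a = begin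
    det (suc (m ℕ.+ 4)) (lap (weight (centered (suc m) a)) (adjacency (S4' (suc m))))
      ≈⟨ det-lap-reindex (suc (m ℕ.+ 4)) (toFront last) (toFront-injective last) _ _ ⟨
    det (suc (m ℕ.+ 4)) (lap (λ i → weight (centered (suc m) a) (toFront last i)) (λ i j → adjacency (S4' (suc m)) (toFront last i) (toFront last j)))
      ≈⟨ det-cong (suc (m ℕ.+ 4)) (lap-cong weights (S4'-suc m)) ⟩
    det (suc (m ℕ.+ 4)) (lap (weight a′) (attachGraph (center m) (adjacency (S4' m))))
      ≈⟨ det-weighted-attach (m ℕ.+ 4) (center m) (adjacency (S4' m)) a′ ⟩
    x * (1# + 0#) * det (m ℕ.+ 4) (lap (weight (centered m a)) (adjacency (S4' m)))
        + det (m ℕ.+ 4) (lap (weight (merge (center m) a′)) (adjacency (S4' m)))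
      ≈⟨ +-cong (*-cong (trans (*-congˡ (+-identityʳ 1#)) (*-identityʳ x)) (det-S4' m a))
           (trans (det-cong (m ℕ.+ 4) (lap-cong (λ i → *-congˡ (+-congˡ (solve 2 (λ a d → a :* d :+ (con (+ 1) :+ con (+ 0)) :* d := (a :+ con (+ 1)) :* d) refl a (δ (center m) i)))) (λ i j → refl)))
                  (det-S4' m (a + 1#))) ⟩
    x * L m a + L m (a + 1#)
      ≈⟨ L-suc m a ⟨
    L (suc m) a ∎
    where
    last : Fin (suc (m ℕ.+ 4))
    last = fromℕ (m ℕ.+ 4)
    a′ : Fin (suc (m ℕ.+ 4)) → Carrier
    a′ zero    = 0#
    a′ (suc i) = centered m a i
    weights : ∀ i → weight (centered (suc m) a) (toFront last i) ≈ weight a′ i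
    weights zero    = *-congˡ (+-congˡ (trans (*-congˡ (trans (δ-sym _ last) (δ-punchIn last (center m)))) (zeroʳ a)))
    weights (suc i) = *-congˡ (+-congˡ (*-congˡ (δ-injective (punchIn last) (λ {i} {j} → punchIn-injective last i j) (center m) i)))

  indicator-true : ∀ {b} → b ≡ true → 1# ⊑ indicator b
  indicator-true ≡.refl = ⊑-refl

  δ⊑indicator : ∀ {n} (u j : Fin n) b → (u ≡ j → b ≡ true) → δ u j ⊑ indicator b
  δ⊑indicator u j b imp with u ≟ j
  ... | yes u≡j@≡.refl = ⊑-resp (sym (δ-diag u)) refl (indicator-true (imp u≡j))
  ... | no u≢j         = ⊑-resp (sym (δ-off u≢j)) refl (0⊑ (indicator-nonNeg b))

  chain-entry : ∀ n i j → chain n i j ≈ 0# ⊎ (chain n i j ≈ 1# × (suc (toℕ i) ≡ toℕ j ⊎ suc (toℕ j) ≡ toℕ i))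
  chain-entry zero    i             j             = inj₁ refl
  chain-entry (suc n) zero          zero          = inj₁ refl
  chain-entry (suc n) zero          (suc zero)    = inj₂ (refl , inj₁ ≡.refl)
  chain-entry (suc n) zero          (suc (suc j)) = inj₁ refl
  chain-entry (suc n) (suc zero)    zero          = inj₂ (refl , inj₂ ≡.refl)
  chain-entry (suc n) (suc (suc i)) zero          = inj₁ refl
  chain-entry (suc n) (suc i)       (suc j) with chain-entry n i j
  ... | inj₁ eq              = inj₁ eq
  ... | inj₂ (eq , inj₁ adj) = inj₂ (eq , inj₁ (≡.cong suc adj))
  ... | inj₂ (eq , inj₂ adj) = inj₂ (eq , inj₂ (≡.cong suc adj))

  closing-entry : ∀ n (i j : Fin (suc (suc n))) → closing (suc n) i j ≈ 0# ⊎
    (closing (suc n) i j ≈ 1# × ((toℕ i ≡ 0 × toℕ j ≡ suc n) ⊎ (toℕ j ≡ 0 × toℕ i ≡ suc n)))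
  closing-entry n zero zero = inj₁ (solve 0 (con (+ 1) :* con (+ 0) :+ con (+ 0) :* con (+ 1) := con (+ 0)) refl)
  closing-entry n zero (suc j) with fromℕ n ≟ j
  ... | yes ≡.refl = inj₂ (trans (+-congʳ (*-congˡ (δ-diag (fromℕ n)))) (solve 0 (con (+ 1) :* con (+ 1) :+ con (+ 0) :* con (+ 0) := con (+ 1)) refl) , inj₁ (≡.refl , ≡.cong suc (toℕ-fromℕ n)))
  ... | no ne = inj₁ (trans (+-congʳ (*-congˡ (δ-off ne))) (solve 0 (con (+ 1) :* con (+ 0) :+ con (+ 0) :* con (+ 0) := con (+ 0)) refl))
  closing-entry n (suc i) zero with fromℕ n ≟ i
  ... | yes ≡.refl = inj₂ (trans (+-congˡ (*-congʳ (δ-diag (fromℕ n)))) (solve 0 (con (+ 0) :* con (+ 0) :+ con (+ 1) :* con (+ 1) := con (+ 1)) refl) , inj₂ (≡.refl , ≡.cong suc (toℕ-fromℕ n)))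
  ... | no ne = inj₁ (trans (+-congˡ (*-congʳ (δ-off ne))) (solve 0 (con (+ 0) :* con (+ 0) :+ con (+ 0) :* con (+ 1) := con (+ 0)) refl))
  closing-entry n (suc i) (suc j) = inj₁ (trans (+-cong (zeroˡ _) (zeroʳ _)) (+-identityˡ 0#))

  chain-nonNeg : ∀ n i j → NonNeg (chain n i j)
  chain-nonNeg n i j with chain-entry n i j
  ... | inj₁ eq       = nonNeg-resp (sym eq) nonNeg-0
  ... | inj₂ (eq , _) = nonNeg-resp (sym eq) nonNeg-1

  cycleGraph-nonNeg : ∀ n i j → NonNeg (cycleGraph n i j)
  cycleGraph-nonNeg n i j = nonNeg-+ (chain-nonNeg n i j)
    (nonNeg-+ (nonNeg-* (δ-nonNeg zero i) (δ-nonNeg (fromℕ n) j)) (nonNeg-* (δ-nonNeg (fromℕ n) i) (δ-nonNeg zero j)))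

  sg-double : ∀ t → sg (t ℕ.+ t) ≈ 1#
  sg-double zero    = refl
  sg-double (suc t) = trans (reflexive (≡.cong (λ k → - sg k) (ℕₚ.+-suc t t))) (trans (solve 1 (λ a → :- (:- a) := a) refl _) (sg-double t))

  module _ {N} (G : Graph N) (simple : Simple G) (connected : Connected G) where

    -- A path edge joins consecutive labels and the closing edge joins 0 and 3 + h. No pair is both,
    -- so each entry of the sum is 0 or 1 and the 1s are edges of `G`.
    cycleGraph⊑ : ∀ h (cyc : Fin (4 ℕ.+ h) → Fin N) → IsCycle G (4 ℕ.+ h) cyc →
      ∀ i j → cycleGraph (3 ℕ.+ h) i j ⊑ indicator (G (cyc i) (cyc j))
    cycleGraph⊑ h cyc (_ , _ , edges) i j with chain-entry (3 ℕ.+ h) i j | closing-entry (2 ℕ.+ h) i j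
    ... | inj₁ p | inj₁ q = ⊑-resp (sym (trans (+-cong p q) (+-identityˡ 0#))) refl (0⊑ (indicator-nonNeg (G (cyc i) (cyc j))))
    ... | inj₂ (p , adj) | inj₁ q = ⊑-resp (sym (trans (+-cong p q) (+-identityʳ 1#))) refl (indicator-true (joined adj))
      where
      joined : suc (toℕ i) ≡ toℕ j ⊎ suc (toℕ j) ≡ toℕ i → G (cyc i) (cyc j) ≡ true
      joined (inj₁ eq) = edges i j (inj₁ eq)
      joined (inj₂ eq) = ≡.trans (proj₁ simple (cyc i) (cyc j)) (edges j i (inj₁ eq))
    ... | inj₁ p | inj₂ (q , ends) = ⊑-resp (sym (trans (+-cong p q) (+-identityˡ 1#))) refl (indicator-true (joined ends))
      where
      joined : (toℕ i ≡ 0 × toℕ j ≡ 3 ℕ.+ h) ⊎ (toℕ j ≡ 0 × toℕ i ≡ 3 ℕ.+ h) → G (cyc i) (cyc j) ≡ true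
      joined (inj₁ (i≡0 , j≡)) = ≡.trans (proj₁ simple (cyc i) (cyc j)) (edges j i (inj₂ (≡.cong suc j≡ , i≡0)))
      joined (inj₂ (j≡0 , i≡)) = edges i j (inj₂ (≡.cong suc i≡ , j≡0))
    ... | inj₂ (_ , adj) | inj₂ (_ , ends) = ⊥-elim (clash adj ends)
      where
      clash : suc (toℕ i) ≡ toℕ j ⊎ suc (toℕ j) ≡ toℕ i → ¬ ((toℕ i ≡ 0 × toℕ j ≡ 3 ℕ.+ h) ⊎ (toℕ j ≡ 0 × toℕ i ≡ 3 ℕ.+ h))
      clash (inj₁ p) (inj₁ (q , r)) with () ← ≡.trans (≡.trans (≡.cong suc (≡.sym q)) p) r
      clash (inj₁ p) (inj₂ (q , r)) with () ← ≡.trans p q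
      clash (inj₂ p) (inj₁ (q , r)) with () ← ≡.trans p q
      clash (inj₂ p) (inj₂ (q , r)) with () ← ≡.trans (≡.trans (≡.cong suc (≡.sym q)) p) r

    -- `v` lists the vertices reached so far, and the bound concerns the subgraph induced on them.
    Stage : ℕ → Set (c ⊔ ℓ′)
    Stage h = Σ (Fin (4 ℕ.+ h) → Fin N) λ v → Injective _≡_ _≡_ v × Bounded 1# h (4 ℕ.+ h) (λ i j → adjacency G (v i) (v j))

    cycle-stage : ∀ h (cyc : Fin (4 ℕ.+ h) → Fin N) → IsCycle G (4 ℕ.+ h) cyc → sg h ≈ 1# → Stage h
    cycle-stage h cyc isCycle even = cyc , proj₁ (proj₂ isCycle) ,
      mono-bounded 1# h (4 ℕ.+ h) (cycleGraph (3 ℕ.+ h)) _ (cycleGraph-nonNeg (3 ℕ.+ h)) (cycleGraph⊑ h cyc isCycle) (cycle-bounded h even)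

    module _ {k} (v : Fin k → Fin N) where

      Visited : Fin N → Set
      Visited w = ∃ λ i → v i ≡ w

      crossing : ∀ l (q : Fin (suc l) → Fin N) → Visited (q zero) → ¬ Visited (q (fromℕ l)) →
        ∃ λ i → Visited (q (inject₁ i)) × ¬ Visited (q (suc i))
      crossing zero    q inside outside = contradiction inside outside
      crossing (suc l) q inside outside with any? (λ i → v i ≟ q (suc zero))
      ... | no ¬visited = zero , inside , ¬visited
      ... | yes visited with crossing l (λ i → q (suc i)) visited outside
      ...   | i , p = suc i , p

      -- Pigeonhole: choosing an index for every vertex would inject `Fin N` into `Fin k`.
      unvisited : k ℕ.< N → ∃ λ w → ¬ Visited w
      unvisited k<N = ¬∀⟶∃¬ N Visited (λ w → any? (λ i → v i ≟ w)) λ all →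
        ℕₚ.<⇒≱ k<N (injective⇒≤ {f = λ w → proj₁ (all w)} λ {w} {w′} eq →
          ≡.trans (≡.sym (proj₂ (all w))) (≡.trans (≡.cong v eq) (proj₂ (all w′))))

    extend : ∀ {k} → Fin N → (Fin k → Fin N) → Fin (suc k) → Fin N
    extend w v zero    = w
    extend w v (suc i) = v i

    extend-injective : ∀ {k} w (v : Fin k → Fin N) → Injective _≡_ _≡_ v → ¬ Visited v w → Injective _≡_ _≡_ (extend w v)
    extend-injective w v inj new {zero}  {zero}  eq = ≡.refl
    extend-injective w v inj new {zero}  {suc j} eq = contradiction (j , ≡.sym eq) new
    extend-injective w v inj new {suc i} {zero}  eq = contradiction (i , eq) new
    extend-injective w v inj new {suc i} {suc j} eq = ≡.cong suc (inj eq)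

    attach⊑extend : ∀ {k} w (v : Fin k → Fin N) u → G (v u) w ≡ true →
      ∀ i j → attachGraph u (λ i j → adjacency G (v i) (v j)) i j ⊑ adjacency G (extend w v i) (extend w v j)
    attach⊑extend w v u edge zero    zero    = 0⊑ (indicator-nonNeg (G w w))
    attach⊑extend w v u edge zero    (suc j) = δ⊑indicator u j (G w (v j)) λ { ≡.refl → ≡.trans (proj₁ simple w (v u)) edge }
    attach⊑extend w v u edge (suc i) zero    = δ⊑indicator u i (G (v i) w) λ { ≡.refl → edge }
    attach⊑extend w v u edge (suc i) (suc j) = ⊑-refl

    attach-nonNeg : ∀ {k} (v : Fin k → Fin N) u i j → NonNeg (attachGraph u (λ i j → adjacency G (v i) (v j)) i j)
    attach-nonNeg v u zero    zero    = nonNeg-0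
    attach-nonNeg v u zero    (suc j) = δ-nonNeg u j
    attach-nonNeg v u (suc i) zero    = δ-nonNeg u i
    attach-nonNeg v u (suc i) (suc j) = indicator-nonNeg (G (v i) (v j))

    -- A walk from a visited to an unvisited vertex leaves the visited set along some edge. Its far
    -- end is attached by that edge, and monotonicity passes to the induced subgraph.
    grow-step : ∀ h → Stage h → 4 ℕ.+ h ℕ.< N → Stage (suc h)
    grow-step h (v , inj , bound) small with unvisited v small
    ... | w , new with connected (v zero) w
    ... | l , q , q₀ , q₁ , edges with crossing v l q (zero , ≡.sym q₀) (≡.subst (λ w → ¬ Visited v w) (≡.sym q₁) new)
    ... | i , (u , vu≡) , new′ = extend (q (suc i)) v , extend-injective (q (suc i)) v inj new′ ,
      mono-bounded 1# (suc h) (5 ℕ.+ h) _ _ (attach-nonNeg v u)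
        (attach⊑extend (q (suc i)) v u (≡.trans (≡.cong (λ z → G z (q (suc i))) vu≡) (edges i)))
        (attach-bounded 1# nonNeg-1 h (4 ℕ.+ h) u _ bound)

    grow : ∀ d h → Stage h → d ℕ.+ (4 ℕ.+ h) ≡ N → ∃ λ h → 4 ℕ.+ h ≡ N × Stage h
    grow zero    h stage eq = h , eq , stage
    grow (suc d) h stage eq = grow d (suc h) (grow-step h stage (ℕₚ.≤-trans (ℕ.s≤s (ℕₚ.m≤n+m _ d)) (ℕₚ.≤-reflexive eq)))
      (≡.trans (ℕₚ.+-suc d (4 ℕ.+ h)) eq)

    -- With all vertices listed, the injection `v` is a permutation and leaves the determinant
    -- unchanged; a = 0 gives every vertex the weight x.
    conclude : (∃ λ h → 4 ℕ.+ h ≡ N × Stage h) → L (N ℕ.∸ 4) 0# ⊑ det N (lap (λ _ → x) (adjacency G))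
    conclude (h , ≡.refl , v , inj , bound) = ⊑-resp
      (trans (*-identityˡ _) (L-cong h (∑-vanish (λ _ → refl))))
      (trans (det-cong (4 ℕ.+ h) (lap-cong (λ _ → trans (*-congˡ (+-identityʳ 1#)) (*-identityʳ x)) (λ i j → refl)))
             (det-lap-reindex (4 ℕ.+ h) v inj (λ _ → x) (adjacency G)))
      (bound (λ _ → 0#) (λ _ → nonNeg-0))

    lower-bound : EvenGirth G → L (N ℕ.∸ 4) 0# ⊑ det N (lap (λ _ → x) (adjacency G))
    lower-bound (_ , _ , isCycle , (zero , ≡.refl)) with () ← proj₁ isCycle
    lower-bound (_ , _ , isCycle , (suc zero , ≡.refl)) with ℕ.s≤s (ℕ.s≤s ()) ← proj₁ isCycle
    -- The half-length is at least two; writing it 2 + t makes the length 4 + h with h = t + t.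
    lower-bound (_ , cyc , isCycle , (suc (suc t) , ≡.refl)) = go eq cyc isCycle
      where
      eq : 2 ℕ.* (2 ℕ.+ t) ≡ 4 ℕ.+ (t ℕ.+ t)
      eq = ≡.cong (2 ℕ.+_) (≡.trans (≡.cong (t ℕ.+_) (ℕₚ.+-identityʳ (2 ℕ.+ t))) (≡.trans (ℕₚ.+-suc t (suc t)) (≡.cong suc (ℕₚ.+-suc t t))))
      go : ∀ {k} → k ≡ 4 ℕ.+ (t ℕ.+ t) → (cyc : Fin k → Fin N) → IsCycle G k cyc → L (N ℕ.∸ 4) 0# ⊑ det N (lap (λ _ → x) (adjacency G))
      go ≡.refl cyc isCycle = conclude (grow (N ℕ.∸ (4 ℕ.+ (t ℕ.+ t))) (t ℕ.+ t) (cycle-stage (t ℕ.+ t) cyc isCycle (sg-double t))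
        (ℕₚ.m∸n+n≡m (injective⇒≤ (proj₁ (proj₂ isCycle)))))

  S4'-minimal : ∀ m (G : Graph (m ℕ.+ 4)) → Simple G → Connected G → EvenGirth G →
    det (m ℕ.+ 4) (lap (λ _ → x) (adjacency (S4' m))) ⊑ det (m ℕ.+ 4) (lap (λ _ → x) (adjacency G))
  S4'-minimal m G simple connected even = ⊑-resp
    (trans (reflexive (≡.cong (λ k → L k 0#) (ℕₚ.m+n∸n≡m m 4))) (trans (sym (det-S4' m 0#))
      (det-cong (m ℕ.+ 4) (lap-cong (λ i → trans (*-congˡ (trans (+-congˡ (zeroˡ _)) (+-identityʳ 1#))) (*-identityʳ x)) (λ i j → refl)))))
    refl (lower-bound G simple connected even)

-- Integer polynomials as a commutative ring, and the cone of alternating polynomials.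

module PolyRing where
  open import Data.Integer using (-_)
  open +-*-Solver using (solve; con; _:+_; _:*_; :-_; _:=_)
  open ≡.≡-Reasoning

  infix 4 _≋_

  -- Lists differing by trailing zeros are the same polynomial. As a record, the relation lets
  -- unification recover `p` and `q`, which their coefficients would not.
  record _≋_ (p q : Poly) : Set where
    constructor coefficientwise
    field at : ∀ k → coeff p k ≡ coeff q k
  open _≋_ public

  ≋-refl : ∀ {p} → p ≋ p
  ≋-refl .at k = ≡.refl

  ≋-sym : ∀ {p q} → p ≋ q → q ≋ p
  ≋-sym p≋q .at k = ≡.sym (p≋q .at k)

  ≋-trans : ∀ {p q r} → p ≋ q → q ≋ r → p ≋ r
  ≋-trans p≋q q≋r .at k = ≡.trans (p≋q .at k) (q≋r .at k)

  negP : Poly → Poly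
  negP = map (-_)

  coeff-addP : ∀ p q k → coeff (addP p q) k ≡ coeff p k ℤ.+ coeff q k
  coeff-addP []      q       k       = ≡.sym (ℤₚ.+-identityˡ _)
  coeff-addP (a ∷ p) []      k       = ≡.sym (ℤₚ.+-identityʳ _)
  coeff-addP (a ∷ p) (b ∷ q) zero    = ≡.refl
  coeff-addP (a ∷ p) (b ∷ q) (suc k) = coeff-addP p q k

  coeff-scaleP : ∀ a p k → coeff (scaleP a p) k ≡ a ℤ.* coeff p k
  coeff-scaleP a []      k       = ≡.sym (ℤₚ.*-zeroʳ a)
  coeff-scaleP a (b ∷ p) zero    = ≡.refl
  coeff-scaleP a (b ∷ p) (suc k) = coeff-scaleP a p k

  coeff-negP : ∀ p k → coeff (negP p) k ≡ - coeff p k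
  coeff-negP []      k       = ≡.refl
  coeff-negP (b ∷ p) zero    = ≡.refl
  coeff-negP (b ∷ p) (suc k) = coeff-negP p k

  coeff-mulP-zero : ∀ a p q → coeff (mulP (a ∷ p) q) zero ≡ a ℤ.* coeff q zero
  coeff-mulP-zero a p q = ≡.trans (coeff-addP (scaleP a q) (+ 0 ∷ mulP p q) zero)
    (≡.trans (ℤₚ.+-identityʳ _) (coeff-scaleP a q zero))

  coeff-mulP-suc : ∀ a p q k → coeff (mulP (a ∷ p) q) (suc k) ≡ a ℤ.* coeff q (suc k) ℤ.+ coeff (mulP p q) k
  coeff-mulP-suc a p q k = ≡.trans (coeff-addP (scaleP a q) (+ 0 ∷ mulP p q) (suc k))
    (≡.cong (ℤ._+ coeff (mulP p q) k) (coeff-scaleP a q (suc k)))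

  addP-cong : ∀ {p p′ q q′} → p ≋ p′ → q ≋ q′ → addP p q ≋ addP p′ q′
  addP-cong {p} {p′} {q} {q′} e f .at k = ≡.trans (coeff-addP p q k)
    (≡.trans (≡.cong₂ ℤ._+_ (e .at k) (f .at k)) (≡.sym (coeff-addP p′ q′ k)))

  addP-assoc : ∀ p q r → addP (addP p q) r ≋ addP p (addP q r)
  addP-assoc p q r .at k = begin
    coeff (addP (addP p q) r) k                     ≡⟨ ≡.trans (coeff-addP (addP p q) r k) (≡.cong (ℤ._+ _) (coeff-addP p q k)) ⟩
    coeff p k ℤ.+ coeff q k ℤ.+ coeff r k           ≡⟨ ℤₚ.+-assoc (coeff p k) _ _ ⟩
    coeff p k ℤ.+ (coeff q k ℤ.+ coeff r k)         ≡⟨ ≡.trans (coeff-addP p (addP q r) k) (≡.cong (λ z → coeff p k ℤ.+ z) (coeff-addP q r k)) ⟨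
    coeff (addP p (addP q r)) k                     ∎

  addP-comm : ∀ p q → addP p q ≋ addP q p
  addP-comm p q .at k = ≡.trans (coeff-addP p q k) (≡.trans (ℤₚ.+-comm (coeff p k) _) (≡.sym (coeff-addP q p k)))

  addP-identityʳ : ∀ p → addP p [] ≋ p
  addP-identityʳ p .at k = ≡.trans (coeff-addP p [] k) (ℤₚ.+-identityʳ _)

  negP-cong : ∀ {p q} → p ≋ q → negP p ≋ negP q
  negP-cong {p} {q} e .at k = ≡.trans (coeff-negP p k) (≡.trans (≡.cong -_ (e .at k)) (≡.sym (coeff-negP q k)))

  negP-inverseʳ : ∀ p → addP p (negP p) ≋ []
  negP-inverseʳ p .at k = ≡.trans (coeff-addP p (negP p) k) (≡.trans (≡.cong (λ z → coeff p k ℤ.+ z) (coeff-negP p k)) (ℤₚ.+-inverseʳ (coeff p k)))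

  mulP-congˡ : ∀ p {q q′} → q ≋ q′ → mulP p q ≋ mulP p q′
  mulP-congˡ []      e .at k       = ≡.refl
  mulP-congˡ (a ∷ p) {q} {q′} e .at zero    = ≡.trans (coeff-mulP-zero a p q) (≡.trans (≡.cong (a ℤ.*_) (e .at zero)) (≡.sym (coeff-mulP-zero a p q′)))
  mulP-congˡ (a ∷ p) {q} {q′} e .at (suc k) = ≡.trans (coeff-mulP-suc a p q k)
    (≡.trans (≡.cong₂ (λ b d → a ℤ.* b ℤ.+ d) (e .at (suc k)) (mulP-congˡ p e .at k)) (≡.sym (coeff-mulP-suc a p q′ k)))

  mulP-zeroʳ : ∀ p → mulP p [] ≋ []
  mulP-zeroʳ []      .at k       = ≡.refl
  mulP-zeroʳ (a ∷ p) .at zero    = ≡.refl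
  mulP-zeroʳ (a ∷ p) .at (suc k) = mulP-zeroʳ p .at k

  -- The mirror image of the defining clause of `mulP`, from which commutativity follows by
  -- induction on the left factor.
  mulP-∷ʳ : ∀ p b q → mulP p (b ∷ q) ≋ addP (scaleP b p) (+ 0 ∷ mulP p q)
  mulP-∷ʳ []      b q .at zero    = ≡.refl
  mulP-∷ʳ []      b q .at (suc k) = ≡.refl
  mulP-∷ʳ (a ∷ p) b q .at zero    = ≡.cong (ℤ._+ + 0) (ℤₚ.*-comm a b)
  mulP-∷ʳ (a ∷ p) b q .at (suc k) = begin
    coeff (addP (scaleP a q) (mulP p (b ∷ q))) k
      ≡⟨ coeff-addP (scaleP a q) _ k ⟩
    s ℤ.+ coeff (mulP p (b ∷ q)) k
      ≡⟨ ≡.cong (λ z → s ℤ.+ z) (≡.trans (mulP-∷ʳ p b q .at k) (coeff-addP (scaleP b p) _ k)) ⟩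
    s ℤ.+ (t ℤ.+ u)
      ≡⟨ solve 3 (λ s t u → s :+ (t :+ u) := t :+ (s :+ u)) ≡.refl s t u ⟩
    t ℤ.+ (s ℤ.+ u)
      ≡⟨ ≡.trans (coeff-addP (scaleP b p) _ k) (≡.cong (λ z → t ℤ.+ z) (coeff-addP (scaleP a q) _ k)) ⟨
    coeff (addP (scaleP b p) (addP (scaleP a q) (+ 0 ∷ mulP p q))) k ∎
    where
    s = coeff (scaleP a q) k
    t = coeff (scaleP b p) k
    u = coeff (+ 0 ∷ mulP p q) k

  ∷-cong : ∀ {a p q} → p ≋ q → (a ∷ p) ≋ (a ∷ q)
  ∷-cong e .at zero    = ≡.refl
  ∷-cong e .at (suc k) = e .at k

  mulP-comm : ∀ p q → mulP p q ≋ mulP q p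
  mulP-comm []      q = ≋-sym (mulP-zeroʳ q)
  mulP-comm (a ∷ p) q = ≋-trans (addP-cong {scaleP a q} ≋-refl (∷-cong (mulP-comm p q))) (≋-sym (mulP-∷ʳ q a p))

  mulP-cong : ∀ {p p′ q q′} → p ≋ p′ → q ≋ q′ → mulP p q ≋ mulP p′ q′
  mulP-cong {p} {p′} {q} {q′} e f = ≋-trans (mulP-congˡ p f)
    (≋-trans (mulP-comm p q′) (≋-trans (mulP-congˡ q′ e) (mulP-comm q′ p′)))

  mulP-distribˡ : ∀ p q r → mulP p (addP q r) ≋ addP (mulP p q) (mulP p r)
  mulP-distribˡ []      q r .at k    = ≡.refl
  mulP-distribˡ (a ∷ p) q r .at zero = begin
    coeff (mulP (a ∷ p) (addP q r)) zero                    ≡⟨ ≡.trans (coeff-mulP-zero a p (addP q r)) (≡.cong (a ℤ.*_) (coeff-addP q r zero)) ⟩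
    a ℤ.* (coeff q zero ℤ.+ coeff r zero)                   ≡⟨ ℤₚ.*-distribˡ-+ a _ _ ⟩
    a ℤ.* coeff q zero ℤ.+ a ℤ.* coeff r zero               ≡⟨ ≡.cong₂ ℤ._+_ (coeff-mulP-zero a p q) (coeff-mulP-zero a p r) ⟨
    coeff (mulP (a ∷ p) q) zero ℤ.+ coeff (mulP (a ∷ p) r) zero ≡⟨ coeff-addP (mulP (a ∷ p) q) _ zero ⟨
    coeff (addP (mulP (a ∷ p) q) (mulP (a ∷ p) r)) zero     ∎
  mulP-distribˡ (a ∷ p) q r .at (suc k) = begin
    coeff (mulP (a ∷ p) (addP q r)) (suc k)
      ≡⟨ ≡.trans (coeff-mulP-suc a p (addP q r) k) (≡.cong₂ (λ b d → a ℤ.* b ℤ.+ d) (coeff-addP q r (suc k)) (≡.trans (mulP-distribˡ p q r .at k) (coeff-addP (mulP p q) _ k))) ⟩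
    a ℤ.* (s ℤ.+ t) ℤ.+ (u ℤ.+ v)
      ≡⟨ solve 5 (λ a s t u v → a :* (s :+ t) :+ (u :+ v) := (a :* s :+ u) :+ (a :* t :+ v)) ≡.refl a s t u v ⟩
    (a ℤ.* s ℤ.+ u) ℤ.+ (a ℤ.* t ℤ.+ v)
      ≡⟨ ≡.cong₂ ℤ._+_ (coeff-mulP-suc a p q k) (coeff-mulP-suc a p r k) ⟨
    coeff (mulP (a ∷ p) q) (suc k) ℤ.+ coeff (mulP (a ∷ p) r) (suc k)
      ≡⟨ coeff-addP (mulP (a ∷ p) q) _ (suc k) ⟨
    coeff (addP (mulP (a ∷ p) q) (mulP (a ∷ p) r)) (suc k) ∎
    where
    s = coeff q (suc k)
    t = coeff r (suc k)
    u = coeff (mulP p q) k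
    v = coeff (mulP p r) k

  mulP-distribʳ : ∀ r p q → mulP (addP p q) r ≋ addP (mulP p r) (mulP q r)
  mulP-distribʳ r p q = ≋-trans (mulP-comm (addP p q) r) (≋-trans (mulP-distribˡ r p q) (addP-cong (mulP-comm r p) (mulP-comm r q)))

  mulP-scaleP : ∀ a p q → mulP (scaleP a p) q ≋ scaleP a (mulP p q)
  mulP-scaleP a []      q .at k    = ≡.refl
  mulP-scaleP a (b ∷ p) q .at zero = ≡.trans (coeff-mulP-zero (a ℤ.* b) (scaleP a p) q) (≡.trans (ℤₚ.*-assoc a b _)
    (≡.sym (≡.trans (coeff-scaleP a (mulP (b ∷ p) q) zero) (≡.cong (a ℤ.*_) (coeff-mulP-zero b p q)))))
  mulP-scaleP a (b ∷ p) q .at (suc k) = begin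
    coeff (mulP (scaleP a (b ∷ p)) q) (suc k)
      ≡⟨ ≡.trans (coeff-mulP-suc (a ℤ.* b) (scaleP a p) q k) (≡.cong (λ d → a ℤ.* b ℤ.* s ℤ.+ d) (≡.trans (mulP-scaleP a p q .at k) (coeff-scaleP a (mulP p q) k))) ⟩
    a ℤ.* b ℤ.* s ℤ.+ a ℤ.* t
      ≡⟨ solve 4 (λ a b s t → a :* b :* s :+ a :* t := a :* (b :* s :+ t)) ≡.refl a b s t ⟩
    a ℤ.* (b ℤ.* s ℤ.+ t)
      ≡⟨ ≡.trans (coeff-scaleP a (mulP (b ∷ p) q) (suc k)) (≡.cong (a ℤ.*_) (coeff-mulP-suc b p q k)) ⟨
    coeff (scaleP a (mulP (b ∷ p) q)) (suc k) ∎
    where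
    s = coeff q (suc k)
    t = coeff (mulP p q) k

  mulP-shift : ∀ p q → mulP (+ 0 ∷ p) q ≋ (+ 0 ∷ mulP p q)
  mulP-shift p q .at zero    = ≡.trans (coeff-mulP-zero (+ 0) p q) (ℤₚ.*-zeroˡ (coeff q 0))
  mulP-shift p q .at (suc k) = ≡.trans (coeff-mulP-suc (+ 0) p q k)
    (≡.trans (≡.cong (ℤ._+ coeff (mulP p q) k) (ℤₚ.*-zeroˡ (coeff q (suc k)))) (ℤₚ.+-identityˡ _))

  mulP-assoc : ∀ p q r → mulP (mulP p q) r ≋ mulP p (mulP q r)
  mulP-assoc []      q r = ≋-refl
  mulP-assoc (a ∷ p) q r = ≋-trans (mulP-distribʳ r (scaleP a q) (+ 0 ∷ mulP p q))
    (addP-cong (mulP-scaleP a q r) (≋-trans (mulP-shift (mulP p q) r) (∷-cong (mulP-assoc p q r))))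

  mulP-constant : ∀ a p → mulP (a ∷ []) p ≋ scaleP a p
  mulP-constant a p .at zero    = ≡.trans (coeff-mulP-zero a [] p) (≡.sym (coeff-scaleP a p zero))
  mulP-constant a p .at (suc k) = ≡.trans (coeff-mulP-suc a [] p k) (≡.trans (ℤₚ.+-identityʳ _) (≡.sym (coeff-scaleP a p (suc k))))

  mulP-identityˡ : ∀ p → mulP (+ 1 ∷ []) p ≋ p
  mulP-identityˡ p = ≋-trans (mulP-constant (+ 1) p) (coefficientwise λ k → ≡.trans (coeff-scaleP (+ 1) p k) (ℤₚ.*-identityˡ _))

  polyRing : CommutativeRing 0ℓ 0ℓ
  polyRing = record
    { Carrier = Poly
    ; _≈_ = _≋_
    ; _+_ = addP
    ; _*_ = mulP
    ; -_ = negP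
    ; 0# = []
    ; 1# = + 1 ∷ []
    ; isCommutativeRing = record
      { isRing = record
        { +-isAbelianGroup = record
          { isGroup = record
            { isMonoid = record
              { isSemigroup = record
                { isMagma = record
                  { isEquivalence = record { refl = ≋-refl ; sym = ≋-sym ; trans = ≋-trans }
                  ; ∙-cong = addP-cong }
                ; assoc = addP-assoc }
              ; identity = (λ p → ≋-refl) , addP-identityʳ }
            ; inverse = (λ p → ≋-trans (addP-comm (negP p) p) (negP-inverseʳ p)) , negP-inverseʳ
            ; ⁻¹-cong = negP-cong }
          ; comm = addP-comm }
        ; *-cong = mulP-cong
        ; *-assoc = mulP-assoc
        ; *-identity = mulP-identityˡ , (λ p → ≋-trans (mulP-comm p (+ 1 ∷ [])) (mulP-identityˡ p))
        ; distrib = mulP-distribˡ , mulP-distribʳ }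
      ; *-comm = mulP-comm } }

  -- AlternatingFrom 1 p says that p(−x) has nonnegative coefficients, so that −X counts as nonnegative:
  -- this absorbs the sign (−1)ⁱ of φᵢ.
  AlternatingFrom : ℤ → Poly → Set
  AlternatingFrom ε p = ∀ k → + 0 ℤ.≤ ε ℤ.* sgn k ℤ.* coeff p k

  0≤-+ : ∀ {a b} → + 0 ℤ.≤ a → + 0 ℤ.≤ b → + 0 ℤ.≤ a ℤ.+ b
  0≤-+ = ℤₚ.+-mono-≤

  0≤-* : ∀ {a b} → + 0 ℤ.≤ a → + 0 ℤ.≤ b → + 0 ℤ.≤ a ℤ.* b
  0≤-* {+ m} {+ n} _ _ = ℤₚ.≤-trans (ℤ.+≤+ ℕ.z≤n) (ℤₚ.≤-reflexive (ℤₚ.pos-* m n))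

  Alternating : Poly → Set
  Alternating = AlternatingFrom (+ 1)

  -- Passing to the tail of `p` lowers its degrees by one and reverses the sign pattern; `ε` carries
  -- this through the induction.
  alternating-* : ∀ ε p q → AlternatingFrom ε p → Alternating q → AlternatingFrom ε (mulP p q)
  alternating-* ε []      q p≥0 q≥0 k = ℤₚ.≤-reflexive (≡.sym (ℤₚ.*-zeroʳ (ε ℤ.* sgn k)))
  alternating-* ε (a ∷ p) q p≥0 q≥0 zero = ≡.subst (+ 0 ℤ.≤_)
    (≡.trans (solve 3 (λ ε a c → ε :* con (+ 1) :* a :* (con (+ 1) :* con (+ 1) :* c) := ε :* con (+ 1) :* (a :* c)) ≡.refl ε a (coeff q zero))
             (≡.cong (ε ℤ.* + 1 ℤ.*_) (≡.sym (coeff-mulP-zero a p q))))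
    (0≤-* (p≥0 zero) (q≥0 zero))
  alternating-* ε (a ∷ p) q p≥0 q≥0 (suc k) = ≡.subst (+ 0 ℤ.≤_)
    (≡.trans (solve 5 (λ ε a s c d → ε :* con (+ 1) :* a :* (con (+ 1) :* (:- s) :* c) :+ (:- ε) :* s :* d := ε :* (:- s) :* (a :* c :+ d)) ≡.refl ε a (sgn k) (coeff q (suc k)) (coeff (mulP p q) k))
             (≡.cong (ε ℤ.* (- sgn k) ℤ.*_) (≡.sym (coeff-mulP-suc a p q k))))
    (0≤-+ (0≤-* (p≥0 zero) (q≥0 (suc k)))
          (alternating-* (- ε) p q (λ j → ≡.subst (+ 0 ℤ.≤_) (solve 3 (λ ε s c → ε :* (:- s) :* c := (:- ε) :* s :* c) ≡.refl ε (sgn j) (coeff p j)) (p≥0 (suc j))) q≥0 k))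

  alternatingCone : PositiveCone polyRing 0ℓ
  alternatingCone = record
    { NonNeg = Alternating
    ; nonNeg-resp = λ e p≥0 k → ≡.subst (λ c → + 0 ℤ.≤ + 1 ℤ.* sgn k ℤ.* c) (e .at k) (p≥0 k)
    ; nonNeg-0 = λ k → ℤₚ.≤-reflexive (≡.sym (ℤₚ.*-zeroʳ (+ 1 ℤ.* sgn k)))
    ; nonNeg-1 = λ { zero → ℤ.+≤+ ℕ.z≤n ; (suc k) → ℤₚ.≤-reflexive (≡.sym (ℤₚ.*-zeroʳ (+ 1 ℤ.* sgn (suc k)))) }
    ; nonNeg-+ = λ {p} {q} p≥0 q≥0 k → ≡.subst (+ 0 ℤ.≤_)
        (≡.trans (≡.sym (ℤₚ.*-distribˡ-+ (+ 1 ℤ.* sgn k) _ _)) (≡.cong (+ 1 ℤ.* sgn k ℤ.*_) (≡.sym (coeff-addP p q k)))) (0≤-+ (p≥0 k) (q≥0 k))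
    ; nonNeg-* = λ {p} {q} → alternating-* (+ 1) p q }

open PolyRing
open import Data.Integer using (-_)
open import Defs hiding (Graph; Simple; Connected; IsCycle; EvenGirth; Poly; addP; scaleP; mulP; coeff; sgn; s4edge; S4')

-- The characteristic polynomial and its signs.

-X : Poly
-X = + 0 ∷ - + 1 ∷ []

-X-alternating : Alternating -X
-X-alternating zero          = ℤ.+≤+ ℕ.z≤n
-X-alternating (suc zero)    = ℤ.+≤+ ℕ.z≤n
-X-alternating (suc (suc k)) = ℤₚ.≤-reflexive (≡.sym (ℤₚ.*-zeroʳ (+ 1 ℤ.* sgn (suc (suc k)))))

open CommutativeRing polyRing using (*-cong; +-cong; +-congˡ; +-congʳ; zeroˡ; +-identityˡ; +-identityʳ; *-identityˡ)
open Determinant polyRing renaming (det to detR) using (sg; ∑; ∑-zero; ∑-suc; det-empty; det-expand; det-neg; δ-diag; δ-off)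
open Laplacian polyRing using (lap)
open Positivity polyRing alternatingCone using (_⊑_)
open Growth polyRing alternatingCone -X -X-alternating using (indicator; adjacency; S4'-minimal)

sg≋sgn : ∀ k → sg k ≋ (sgn k ∷ [])
sg≋sgn zero    = ≋-refl
sg≋sgn (suc k) = negP-cong (sg≋sgn k)

sumP≋∑ : ∀ {n} {f g : Fin n → Poly} → (∀ j → f j ≋ g j) → sumP f ≋ ∑ g
sumP≋∑ {zero}  {f} {g} e = ≋-sym (∑-zero g)
sumP≋∑ {suc n} {f} {g} e = ≋-trans (+-cong (e zero) (sumP≋∑ (λ j → e (suc j)))) (≋-sym (∑-suc g))

det≋detR : ∀ n {M N : Fin n → Fin n → Poly} → (∀ i j → M i j ≋ N i j) → det n M ≋ detR n N
det≋detR zero    {M} {N} e = ≋-sym (det-empty N)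
det≋detR (suc n) {M} {N} e = ≋-trans
  (sumP≋∑ λ j → ≋-trans (≋-sym (mulP-constant (sgn (toℕ j)) (mulP (M zero j) (det n (λ r s → M (suc r) (punchIn j s))))))
    (*-cong (≋-sym (sg≋sgn (toℕ j))) (*-cong (e zero j) (det≋detR n (λ r s → e (suc r) (punchIn j s))))))
  (≋-sym (det-expand n N))

∑-indicator : ∀ {n} (f : Fin n → Bool) → ∑ (λ j → indicator (f j)) ≋ (+ sumℕ (λ j → if f j then 1 else 0) ∷ [])
∑-indicator {zero}  f = ≋-trans (∑-zero _) (coefficientwise λ { zero → ≡.refl ; (suc k) → ≡.refl })
∑-indicator {suc n} f = ≋-trans (∑-suc _) (≋-trans (+-congˡ {indicator (f zero)} (∑-indicator (λ j → f (suc j)))) (first (f zero)))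
  where
  first : ∀ b {d} → addP (indicator b) (+ d ∷ []) ≋ (+ ((if b then 1 else 0) ℕ.+ d) ∷ [])
  first true  = ≋-refl
  first false = ≋-refl

≡ᵇ-true : ∀ {n} (i j : Fin n) → (toℕ i ≡ᵇ toℕ j) ≡ true → i ≡ j
≡ᵇ-true i j eq = toℕ-injective (ℕₚ.≡ᵇ⇒≡ (toℕ i) (toℕ j) (≡.subst T (≡.sym eq) _))

≡ᵇ-false : ∀ {n} (i j : Fin n) → (toℕ i ≡ᵇ toℕ j) ≡ false → i ≡.≢ j
≡ᵇ-false i .i eq ≡.refl = ≡.subst T eq (ℕₚ.≡⇒≡ᵇ (toℕ i) (toℕ i) ≡.refl)

charMat≋ : ∀ {n} (G : Graph n) → Simple G → ∀ i j → charMat G i j ≋ negP (lap (λ _ → -X) (adjacency G) i j)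
charMat≋ G simple i j with toℕ i ≡ᵇ toℕ j in eq
... | true with ≡.refl ← ≡ᵇ-true i j eq = ≋-trans
  (coefficientwise λ { zero → ≡.cong -_ (≡.sym (ℤₚ.+-identityˡ _)) ; (suc k) → ≡.refl })
  (negP-cong (≋-sym (≋-trans
    (+-cong (*-cong (δ-diag i) (+-congˡ { -X } (∑-indicator (G i)))) (loopless (proj₂ simple i)))
    (≋-trans (+-identityʳ _) (*-identityˡ (addP -X (+ degree G i ∷ [])))))))
  where
  loopless : ∀ {b} → b ≡ false → indicator b ≋ []
  loopless ≡.refl = ≋-refl
... | false = ≋-trans (entry (G i j)) (negP-cong (≋-sym (≋-trans (+-congʳ (≋-trans (*-cong (δ-off (≡ᵇ-false i j eq)) ≋-refl) (zeroˡ (addP -X (∑ (adjacency G i)))))) (+-identityˡ _))))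
  where
  entry : ∀ b → (- b2ℤ b ∷ []) ≋ negP (indicator b)
  entry true  = ≋-refl
  entry false = coefficientwise λ { zero → ≡.refl ; (suc k) → ≡.refl }

D : ∀ {n} → Graph n → Poly
D {n} G = detR n (lap (λ _ → -X) (adjacency G))

coeff-charPoly : ∀ {n} (G : Graph n) → Simple G → ∀ k → coeff (charPoly G) k ≡ sgn n ℤ.* coeff (D G) k
coeff-charPoly {n} G simple k = ≡.trans
  (≋-trans (det≋detR n (charMat≋ G simple)) (≋-trans (det-neg n _) (≋-trans (*-cong (sg≋sgn n) ≋-refl) (mulP-constant (sgn n) (D G)))) .at k)
  (coeff-scaleP (sgn n) (D G) k)

sgn-+ : ∀ i j → sgn (i ℕ.+ j) ≡ sgn i ℤ.* sgn j
sgn-+ zero    j = ≡.sym (ℤₚ.*-identityˡ _)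
sgn-+ (suc i) j = ≡.trans (≡.cong -_ (sgn-+ i j)) (ℤₚ.neg-distribˡ-* (sgn i) (sgn j))

sgn-square : ∀ i → sgn i ℤ.* sgn i ≡ + 1
sgn-square zero    = ≡.refl
sgn-square (suc i) = ≡.trans (solve 1 (λ s → (:- s) :* (:- s) := s :* s) ≡.refl (sgn i)) (sgn-square i)
  where open +-*-Solver

-- The signs (-1)ⁱ and (-1)ⁿ combine to the sign at degree n - i, exactly the one the alternating
-- cone attaches to that coefficient. The bound on `i` makes the truncated subtraction exact.
φ-D : ∀ {n} (G : Graph n) → Simple G → ∀ i → i ℕ.≤ n → φ G i ≡ sgn (n ℕ.∸ i) ℤ.* coeff (D G) (n ℕ.∸ i)
φ-D {n} G simple i i≤n = begin
  sgn i ℤ.* coeff (charPoly G) k         ≡⟨ ≡.cong (sgn i ℤ.*_) (coeff-charPoly G simple k) ⟩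
  sgn i ℤ.* (sgn n ℤ.* d)                ≡⟨ ≡.cong (λ s → sgn i ℤ.* (s ℤ.* d)) (≡.trans (≡.cong sgn (≡.sym (ℕₚ.m+[n∸m]≡n i≤n))) (sgn-+ i k)) ⟩
  sgn i ℤ.* (sgn i ℤ.* sgn k ℤ.* d)      ≡⟨ solve 3 (λ s t d → s :* (s :* t :* d) := (s :* s) :* (t :* d)) ≡.refl (sgn i) (sgn k) d ⟩
  sgn i ℤ.* sgn i ℤ.* (sgn k ℤ.* d)      ≡⟨ ≡.cong (ℤ._* (sgn k ℤ.* d)) (sgn-square i) ⟩
  + 1 ℤ.* (sgn k ℤ.* d)                  ≡⟨ ℤₚ.*-identityˡ _ ⟩
  sgn k ℤ.* d                            ∎
  where
  open ≡.≡-Reasoning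
  open +-*-Solver
  k = n ℕ.∸ i
  d = coeff (D G) k

S4'-simple : ∀ m → Simple (S4' m)
S4'-simple m = (λ i j → ∨-comm (s4edge (toℕ i) (toℕ j)) _) , (λ i → ≡.cong₂ _∨_ (irreflexive (toℕ i)) (irreflexive (toℕ i)))
  where
  irreflexive : ∀ a → s4edge a a ≡ false
  irreflexive 0 = ≡.refl
  irreflexive 1 = ≡.refl
  irreflexive 2 = ≡.refl
  irreflexive 3 = ≡.refl
  irreflexive (suc (suc (suc (suc a)))) = ≡.refl

⊑⇒≤ : ∀ {p q} → p ⊑ q → ∀ k → sgn k ℤ.* coeff p k ℤ.≤ sgn k ℤ.* coeff q k
⊑⇒≤ {p} {q} p⊑q k = ℤₚ.0≤i-j⇒j≤i (≡.subst (+ 0 ℤ.≤_) eq (p⊑q k))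
  where
  open +-*-Solver
  eq : + 1 ℤ.* sgn k ℤ.* coeff (addP q (negP p)) k ≡ sgn k ℤ.* coeff q k ℤ.- sgn k ℤ.* coeff p k
  eq = ≡.trans (≡.cong (+ 1 ℤ.* sgn k ℤ.*_) (≡.trans (coeff-addP q (negP p) k) (≡.cong (λ z → coeff q k ℤ.+ z) (coeff-negP p k))))
    (solve 3 (λ s a b → con (+ 1) :* s :* (a :+ (:- b)) := s :* a :- s :* b) ≡.refl (sgn k) (coeff q k) (coeff p k))

open import Data.Nat using (_+_; _≤_)
open import Data.Integer using () renaming (_≤_ to _≤ℤ_)

theorem5p2 : ∀ (m : ℕ) (G : Graph (m + 4)) → Unicyclic G → EvenGirth G →
  ∀ (i : ℕ) → i ≤ m + 4 → φ (S4' m) i ≤ℤ φ G i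
theorem5p2 m G (simple , connected , _) even i i≤n =
  ≡.subst₂ _≤ℤ_ (≡.sym (φ-D (S4' m) (S4'-simple m) i i≤n)) (≡.sym (φ-D G simple i i≤n))
    (⊑⇒≤ {D (S4' m)} {D G} (S4'-minimal m G simple connected even) (m + 4 ℕ.∸ i))
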